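{- Let $(s_n)_{n\ge 0}$ be the little Schröder numbers. For all integers $n,k$ with $1\le k<n$, \[ B_{n,k}(1!s_0,2!s_1,3!s_2,\dots)=\frac{n!}{(k-1)!}\sum_{j=1}^{n-k}\frac{1}{j}\binom{n-k-1}{j-1}\binom{n+j-1}{j-1}. \]
   Context: A Schröder path is a lattice path with steps $\mathsf{E}=(1,0)$, $\mathsf{N}=(0,1)$, $\mathsf{D}=(1,1)$ that stays weakly above the line $y=x$. The little Schröder number $s_n$ ($n\ge 0$) is the number of Schröder paths from $(0,0)$ to $(n,n)$ having no $\mathsf{D}$-step on the line $y=x$; so $s_0=1,s_1=1,s_2=3,s_3=11,s_4=45,\dots$. For $0\le k\le n$, the (exponential) partial Bell polynomial is \[B_{n,k}(z_1,z_2,\dots)=\sum_{\alpha}\frac{n!}{\alpha_1!\alpha_2!\cdots}\Big(\frac{z_1}{1!}\Big)^{\alpha_1}\Big(\frac{z_2}{2!}\Big)^{\alpha_2}\cdots,\] the sum over all $\alpha=(\alpha_1,\dots,\alpha_{n-k+1})\in\mathbb{N}_0^{n-k+1}$ with $\alpha_1+\alpha_2+\cdots=k$ and $\alpha_1+2\alpha_2+3\alpha_3+\cdots=n$. -}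

module Defs where

open import Data.Bool using (Bool; true; false; _∧_; if_then_else_)
open import Data.Nat as ℕ using (ℕ; zero; suc; _∸_; _≡ᵇ_; _<ᵇ_; _≤ᵇ_)
open import Data.Nat.Combinatorics using (_C_)
open import Data.Nat using (_!)
open import Data.Nat.Properties using (_!≢0)
open import Data.List using (List; []; _∷_; map; concatMap; filter; length; foldr; upTo)
open import Data.Vec as Vec using (Vec; []; _∷_)
open import Data.Integer using (+_)
open import Data.Rational using (ℚ; 0ℚ; 1ℚ; _+_; _*_; _/_)
open import Relation.Nullary.Decidable using (does)
open import Relation.Binary.PropositionalEquality using (_≡_)

data Step : Set where
  E N D : Step

words : ℕ → List (List Step)
words zero    = [] ∷ []
words (suc m) = concatMap (λ w → (E ∷ w) ∷ (N ∷ w) ∷ (D ∷ w) ∷ []) (words m)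

-- `walk n x y w` : starting at the current point (x , y) (with y ≥ x),
-- following the steps w stays weakly above y = x, uses no D-step on the
-- line y = x, and ends at (n , n).
walk : ℕ → ℕ → ℕ → List Step → Bool
walk n x y []      = (x ≡ᵇ n) ∧ (y ≡ᵇ n)
walk n x y (E ∷ w) = (suc x ≤ᵇ y) ∧ walk n (suc x) y w
walk n x y (N ∷ w) = walk n x (suc y) w
walk n x y (D ∷ w) = (x <ᵇ y) ∧ walk n (suc x) (suc y) w
-- (a D-step starting at (x , y) with y ≥ x lies on the line y = x exactly
--  when x = y; it then ends at (x+1 , x+1).  For x < y it stays above.)

-- Every step increases x + y by at least 1, so a path from (0,0) to (n,n)
-- has at most 2n steps; hence enumerating lengths 0 .. 2n is exhaustive.
littleSchroderPaths : ℕ → List (List Step)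
littleSchroderPaths n =
  concatMap (λ m → filter (λ w → walk n 0 0 w ≟b true) (words m)) (upTo (suc (2 ℕ.* n)))
  where
    open import Data.Bool.Properties using () renaming (_≟_ to _≟b_)

s : ℕ → ℕ
s n = length (littleSchroderPaths n)

_^ℚ_ : ℚ → ℕ → ℚ
q ^ℚ zero  = 1ℚ
q ^ℚ suc m = q * (q ^ℚ m)

sumℚ : List ℚ → ℚ
sumℚ = foldr _+_ 0ℚ

boxVecs : (len b : ℕ) → List (Vec ℕ len)
boxVecs zero    b = [] ∷ []
boxVecs (suc l) b = concatMap (λ a → map (a ∷_) (boxVecs l b)) (upTo (suc b))

Σα : ∀ {l} → Vec ℕ l → ℕ
Σα []      = 0
Σα (a ∷ v) = a ℕ.+ Σα v

Σiα : ∀ {l} → ℕ → Vec ℕ l → ℕ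
Σiα i []      = 0
Σiα i (a ∷ v) = i ℕ.* a ℕ.+ Σiα (suc i) v

∏α! : ∀ {l} → Vec ℕ l → ℕ
∏α! []      = 1
∏α! (a ∷ v) = a ! ℕ.* ∏α! v

∏α!≢0 : ∀ {l} (v : Vec ℕ l) → ℕ.NonZero (∏α! v)
∏α!≢0 []      = _
∏α!≢0 (a ∷ v) = m*n≢0 (a !) (∏α! v) {{a !≢0}} {{∏α!≢0 v}}
  where open import Data.Nat.Properties using (m*n≢0)

∏z : ∀ {l} → (ℕ → ℚ) → ℕ → Vec ℕ l → ℚ
∏z z i []      = 1ℚ
∏z z i (a ∷ v) = ((z i * ((+ 1) / (i !)) {{i !≢0}}) ^ℚ a) * ∏z z (suc i) v

bellTerm : (n : ℕ) → (ℕ → ℚ) → ∀ {l} → Vec ℕ l → ℚ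
bellTerm n z α = ((+ (n !)) / ∏α! α) {{∏α!≢0 α}} * ∏z z 1 α

-- B_{n,k}(z₁, z₂, …); z is indexed from 1 (z 0 is unused).
-- Sum over α ∈ ℕ^{n-k+1} with Σ αᵢ = k and Σ i αᵢ = n
-- (each αᵢ ≤ k is forced by Σ αᵢ = k, so the box {0..k}^{n-k+1} is exhaustive).
bell : (n k : ℕ) → (ℕ → ℚ) → ℚ
bell n k z =
  sumℚ (map (bellTerm n z)
    (filter (λ α → ((Σα α) ℕ.≟ k) ×-dec ((Σiα 1 α) ℕ.≟ n))
      (boxVecs (suc (n ∸ k)) k)))
  where open import Relation.Nullary.Decidable using (_×-dec_)

zSchroder : ℕ → ℚ
zSchroder zero    = 0ℚ
zSchroder (suc i) = (+ (suc i ! ℕ.* s i)) / 1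

sumFrom1 : ℕ → ((j : ℕ) → .{{ℕ.NonZero j}} → ℚ) → ℚ
sumFrom1 zero    f = 0ℚ
sumFrom1 (suc m) f = sumFrom1 m f + f (suc m)

rhs : (n k : ℕ) → ℚ
rhs n k =
  ((+ (n !)) / ((k ∸ 1) !)) {{(k ∸ 1) !≢0}} *
  sumFrom1 (n ∸ k) (λ j →
    ((+ 1) / j) * ((+ (((n ∸ k ∸ 1) C (j ∸ 1)) ℕ.* ((n ℕ.+ j ∸ 1) C (j ∸ 1)))) / 1))

{-# OPTIONS --safe #-}
module Submission where

-- Put S = Σ s_n x^n. The Bell polynomial satisfies the Euler identity
-- k B_k = Σ_t w_t ∂B_k/∂w_t, whence B_{n,k}(1! s_0, 2! s_1, …) = (n!/k!) [x^(n-k)] S^k.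
-- Decomposing paths by their first step shows that the paths starting at height h above
-- the diagonal are counted by L^h S with L = 2S - 1, and that S = 1 + x L S. So U = S - 1
-- satisfies U = x (1 + U)(1 + 2U), and Lagrange inversion gives
-- m [x^m] S^k = k [u^(m-1)] (1 + u)^(m+k-1) (1 + 2u)^m. Expanding 1 + 2u = (1 + u) + u
-- and m/j C(m-1,j-1) = C(m,j) yield the stated sum.

open import Defs
open import Data.Nat using (ℕ; _≤_; _<_)
open import Relation.Binary.PropositionalEquality using (_≡_)
open import Data.Rational using (ℚ)

open import Algebra using (CommutativeRing)
open import Data.Bool using (Bool; true; false; _∧_; if_then_else_)
open import Data.Bool.Properties using () renaming (_≟_ to _≟ᵇ_)
open import Data.Fin using (toℕ)
open import Data.Fin.Properties using (toℕ<n; toℕ-inject₁; toℕ-fromℕ)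
open import Data.Integer using () renaming (+_ to pos)
import Data.Integer as ℤ
import Data.Integer.Properties as ℤ
open import Data.List using (List; []; _∷_; _++_; map; concatMap; filter; length; applyUpTo)
open import Data.List.Properties using (length-++; map-∘)
open import Data.Maybe using (nothing)
open import Data.Nat hiding (ℕ; _≤_; _<_)
open import Data.Nat.Combinatorics using (_C_; k>n⇒nCk≡0; nCk≡nC[n∸k]; nCk+nC[k+1]≡[n+1]C[k+1])
open import Data.Nat.Properties
open import Data.Nat.Tactic.RingSolver using (solve-∀)
open import Data.Rational using (0ℚ; 1ℚ; fromℚᵘ) renaming (_+_ to _+ℚ_; _*_ to _*ℚ_; _/_ to _/ℚ_)
import Data.Rational.Properties as ℚ
open import Data.Rational.Unnormalised as ℚᵘ using (mkℚᵘ; *≡*)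
import Data.Rational.Unnormalised.Properties as ℚᵘ
open import Data.Vec using (Vec; []; _∷_)
open import Function using (_∘_; id)
open import Relation.Binary.PropositionalEquality hiding (_≡_)
open import Relation.Nullary using (yes; no)
open import Relation.Nullary.Decidable using (_×-dec_; dec-true; dec-false)
open import Tactic.RingSolver using () renaming (solve-∀ to solve-∀-in)
open import Tactic.RingSolver.Core.AlmostCommutativeRing using (AlmostCommutativeRing; fromCommutativeRing)
open import Algebra.Properties.Semiring.Sum +-*-semiring using (sum-syntax; sum-cong-≗; ∑-distrib-+; sum-init-last; sum-replicate-zero)
import Algebra.Properties.Semiring.Sum (CommutativeRing.semiring ℚ.+-*-commutativeRing) as Sumℚ

open ≡-Reasoning

-- No power series is inverted or composed: all that is used about S and L sits in this table. Both
-- exponents are needed because S = 1 + x L S leads out of the powers of S, and because the two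
-- applications use different rows: Bell polynomials need h = 0, path counts need k = 1. The
-- exponent h is a height. A path from height h first reaches each of the heights h - 1, ..., 0 by
-- an E-step; the piece before each of these h steps stays off the diagonal, where D-steps are free,
-- and gives a factor L, while the final piece starts on the diagonal and gives S. The same table
-- makes Lagrange inversion elementary. As S = 1 + U and L = 1 + 2U, row (h, k) is H(U) for H = (1 +
-- 2u)^h (1 + u)^k, so the formula can be proved for all these H together by induction along the
-- clauses; in that induction only H = 1 calls for a derivative. Differences are replaced by terms
-- moved across the equation, so these identities stay in ℕ.

-- Coefficients of the products L^h S^k

-- K h k m is the coefficient of x^m in L^h S^k, where S and L = 2S - 1 are the
-- generating functions of the little and large Schröder numbers; the clauses
-- are S = 1 + x L S and L = 1 + 2 x S L.
K : ℕ → ℕ → ℕ → ℕ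
K h       k       zero    = 1
K zero    zero    (suc m) = 0
K zero    (suc k) (suc m) = K zero k (suc m) + K 1 (suc k) m
K (suc h) k       (suc m) = K h k (suc m) + 2 * K (suc h) (suc k) m

mutual
  -- This is S = 1 + x L S multiplied by L^h S^k; the clauses of `K` contain it only for h = 0.
  -- `K-double`, which is 2S = 1 + L, in degree m yields it in degree m + 1 by induction on h, and
  -- it in turn yields `K-double` in degree m + 1.
  K-sucʳ : ∀ h k m → K h (suc k) (suc m) ≡ K h k (suc m) + K (suc h) (suc k) m
  K-sucʳ zero    k m = refl
  K-sucʳ (suc h) k m = begin
    K h (suc k) (suc m) + 2 * K (suc h) (2 + k) m
      ≡⟨ cong₂ _+_ (K-sucʳ h k m) (K-double (suc h) (suc k) m) ⟩
    (K h k (suc m) + K (suc h) (suc k) m) + (K (suc h) (suc k) m + K (2 + h) (suc k) m)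
      ≡⟨ rearrange (K h k (suc m)) (K (suc h) (suc k) m) (K (2 + h) (suc k) m) ⟩
    K h k (suc m) + 2 * K (suc h) (suc k) m + K (2 + h) (suc k) m ∎
    where
    rearrange : ∀ a b c → (a + b) + (b + c) ≡ a + 2 * b + c
    rearrange = solve-∀

  K-double : ∀ h k m → 2 * K h (suc k) m ≡ K h k m + K (suc h) k m
  K-double h k zero    = refl
  K-double h k (suc m) = begin
    2 * K h (suc k) (suc m)                            ≡⟨ cong (2 *_) (K-sucʳ h k m) ⟩
    2 * (K h k (suc m) + K (suc h) (suc k) m)          ≡⟨ rearrange (K h k (suc m)) _ ⟩
    K h k (suc m) + (K h k (suc m) + 2 * K (suc h) (suc k) m) ∎
    where
    rearrange : ∀ a b → 2 * (a + b) ≡ a + (a + 2 * b)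
    rearrange = solve-∀

-- The relation L = 1 + x L^2 + x L times L^h S. The three terms match the first steps E, N and D of
-- a path from height h + 1.
K-step : ∀ h m → K (suc h) 1 (suc m) ≡ K h 1 (suc m) + (K (2 + h) 1 m + K (suc h) 1 m)
K-step h m = cong (K h 1 (suc m) +_) (trans (K-double (suc h) 1 m) (+-comm (K (suc h) 1 m) _))

conv : (ℕ → ℕ) → (ℕ → ℕ) → ℕ → ℕ
conv p q m = ∑[ t < suc m ] (p (toℕ t) * q (m ∸ toℕ t))

-- As power series the hypotheses read q = q₁ + c x q₂, the common shape of the clauses of `K`.
conv-linear : ∀ c p q q₁ q₂ → q 0 ≡ q₁ 0 → (∀ m → q (suc m) ≡ q₁ (suc m) + c * q₂ m) →
              ∀ m → conv p q (suc m) ≡ conv p q₁ (suc m) + c * conv p q₂ m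
conv-linear c p q q₁ q₂ q0 q+ zero
  rewrite q0 | q+ 0 = rearrange c (p 0) (p 1) (q₁ 0) (q₁ 1) (q₂ 0)
  where
  rearrange : ∀ c a b x y z →
    a * (y + c * z) + (b * x + 0) ≡ a * y + (b * x + 0) + c * (a * z + 0)
  rearrange = solve-∀
conv-linear c p q q₁ q₂ q0 q+ (suc m)
  rewrite q+ (suc m) | conv-linear c (p ∘ suc) q q₁ q₂ q0 q+ m =
  rearrange c (p 0) (q₁ (2 + m)) (q₂ (suc m)) (conv (p ∘ suc) q₁ (suc m)) (conv (p ∘ suc) q₂ m)
  where
  rearrange : ∀ c a y z u v →
    a * (y + c * z) + (u + c * v) ≡ a * y + u + c * (a * z + v)
  rearrange = solve-∀

conv-δ : ∀ p m → conv p (K 0 0) m ≡ p m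
conv-δ p zero    = trans (+-identityʳ _) (*-identityʳ _)
conv-δ p (suc m) = trans (cong (_+ conv (p ∘ suc) (K 0 0) m) (*-zeroʳ (p 0))) (conv-δ (p ∘ suc) m)

-- The clauses of `K` are linear and keep their form when k is raised by one, and convolution with S
-- preserves such recursions. Beyond the constant coefficients this leaves only S^0 = 1 as a base
-- case.
K-conv : ∀ h k m → conv (K 0 1) (K h k) m ≡ K h (suc k) m
K-conv h       k       zero    = refl
K-conv zero    zero    (suc m) = conv-δ (K 0 1) (suc m)
K-conv zero    (suc k) (suc m) = begin
  conv (K 0 1) (K 0 (suc k)) (suc m)
    ≡⟨ conv-linear 1 (K 0 1) (K 0 (suc k)) (K 0 k) (K 1 (suc k)) refl
         (λ i → cong (K 0 k (suc i) +_) (sym (*-identityˡ _))) m ⟩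
  conv (K 0 1) (K 0 k) (suc m) + 1 * conv (K 0 1) (K 1 (suc k)) m
    ≡⟨ cong₂ (λ a b → a + 1 * b) (K-conv 0 k (suc m)) (K-conv 1 (suc k) m) ⟩
  K 0 (suc k) (suc m) + 1 * K 1 (2 + k) m
    ≡⟨ cong (K 0 (suc k) (suc m) +_) (*-identityˡ _) ⟩
  K 0 (2 + k) (suc m) ∎
K-conv (suc h) k       (suc m) = begin
  conv (K 0 1) (K (suc h) k) (suc m)
    ≡⟨ conv-linear 2 (K 0 1) (K (suc h) k) (K h k) (K (suc h) (suc k)) refl (λ _ → refl) m ⟩
  conv (K 0 1) (K h k) (suc m) + 2 * conv (K 0 1) (K (suc h) (suc k)) m
    ≡⟨ cong₂ (λ a b → a + 2 * b) (K-conv h k (suc m)) (K-conv (suc h) (suc k) m) ⟩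
  K (suc h) (suc k) (suc m) ∎

-- Counting Schröder paths

count : (List Step → Bool) → List (List Step) → ℕ
count p []       = 0
count p (w ∷ ws) = (if p w then 1 else 0) + count p ws

length-filter : ∀ p ws → length (filter (λ w → p w ≟ᵇ true) ws) ≡ count p ws
length-filter p []       = refl
length-filter p (w ∷ ws) with p w
... | true  = cong suc (length-filter p ws)
... | false = length-filter p ws

count-extend : ∀ p ws →
  count p (concatMap (λ w → (E ∷ w) ∷ (N ∷ w) ∷ (D ∷ w) ∷ []) ws)
  ≡ count (p ∘ (E ∷_)) ws + (count (p ∘ (N ∷_)) ws + count (p ∘ (D ∷_)) ws)
count-extend p []       = refl
count-extend p (w ∷ ws) rewrite count-extend p ws =
  rearrange (if p (E ∷ w) then 1 else 0) (if p (N ∷ w) then 1 else 0) (if p (D ∷ w) then 1 else 0)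
    (count (p ∘ (E ∷_)) ws) (count (p ∘ (N ∷_)) ws) (count (p ∘ (D ∷_)) ws)
  where
  rearrange : ∀ a b c x y z → a + (b + (c + (x + (y + z)))) ≡ a + x + (b + y + (c + z))
  rearrange = solve-∀

count-∧ : ∀ b p ws → count (λ w → b ∧ p w) ws ≡ (if b then count p ws else 0)
count-∧ true  p ws       = refl
count-∧ false p []       = refl
count-∧ false p (w ∷ ws) = count-∧ false p ws

-- The number of words of length < M leading from (x , y) to (n , n).
paths : (n x y M : ℕ) → ℕ
paths n x y zero    = 0
paths n x y (suc M) =
  (if (x ≡ᵇ n) ∧ (y ≡ᵇ n) then 1 else 0) +
  ((if x <ᵇ y then paths n (suc x) y M else 0) +
  (paths n x (suc y) M +
  (if x <ᵇ y then paths n (suc x) (suc y) M else 0)))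

∑-if : ∀ b (f : ℕ → ℕ) M → ∑[ m < M ] (if b then f (toℕ m) else 0) ≡ (if b then ∑[ m < M ] f (toℕ m) else 0)
∑-if true  f M       = refl
∑-if false f zero    = refl
∑-if false f (suc M) = ∑-if false f M


walkCount : (n x y m : ℕ) → ℕ
walkCount n x y m = count (walk n x y) (words m)

walkCount-suc : ∀ n x y m → walkCount n x y (suc m) ≡
  (if x <ᵇ y then walkCount n (suc x) y m else 0) +
  (walkCount n x (suc y) m + (if x <ᵇ y then walkCount n (suc x) (suc y) m else 0))
walkCount-suc n x y m = begin
  walkCount n x y (suc m)
    ≡⟨ count-extend (walk n x y) (words m) ⟩
  count (λ w → (x <ᵇ y) ∧ walk n (suc x) y w) (words m) +
    (walkCount n x (suc y) m + count (λ w → (x <ᵇ y) ∧ walk n (suc x) (suc y) w) (words m))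
    ≡⟨ cong₂ (λ a b → a + (walkCount n x (suc y) m + b))
         (count-∧ (x <ᵇ y) (walk n (suc x) y) (words m))
         (count-∧ (x <ᵇ y) (walk n (suc x) (suc y)) (words m)) ⟩
  _ ∎

∑-walkCount : ∀ n x y M → ∑[ m < M ] walkCount n x y (toℕ m) ≡ paths n x y M
∑-walkCount n x y zero    = refl
∑-walkCount n x y (suc M) = cong₂ _+_ (+-identityʳ _) (begin
  ∑[ m < M ] walkCount n x y (suc (toℕ m))
    ≡⟨ sum-cong-≗ {M} (λ m → walkCount-suc n x y (toℕ m)) ⟩
  ∑[ m < M ] (e (toℕ m) + (f (toℕ m) + g (toℕ m)))
    ≡⟨ ∑-distrib-+ {M} (e ∘ toℕ) (λ m → f (toℕ m) + g (toℕ m)) ⟩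
  ∑[ m < M ] e (toℕ m) + ∑[ m < M ] (f (toℕ m) + g (toℕ m))
    ≡⟨ cong (∑[ m < M ] e (toℕ m) +_) (∑-distrib-+ {M} (f ∘ toℕ) (g ∘ toℕ)) ⟩
  ∑[ m < M ] e (toℕ m) + (∑[ m < M ] f (toℕ m) + ∑[ m < M ] g (toℕ m))
    ≡⟨ cong₂ _+_ (∑-if (x <ᵇ y) (walkCount n (suc x) y) M)
         (cong (∑[ m < M ] f (toℕ m) +_) (∑-if (x <ᵇ y) (walkCount n (suc x) (suc y)) M)) ⟩
  (if x <ᵇ y then ∑[ m < M ] walkCount n (suc x) y (toℕ m) else 0) +
    (∑[ m < M ] f (toℕ m) + (if x <ᵇ y then ∑[ m < M ] walkCount n (suc x) (suc y) (toℕ m) else 0))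
    ≡⟨ cong₂ _+_ (cong (λ a → if x <ᵇ y then a else 0) (∑-walkCount n (suc x) y M))
         (cong₂ _+_ (∑-walkCount n x (suc y) M)
           (cong (λ a → if x <ᵇ y then a else 0) (∑-walkCount n (suc x) (suc y) M))) ⟩
  _ ∎)
  where
  e f g : ℕ → ℕ
  e m = if x <ᵇ y then walkCount n (suc x) y m else 0
  f m = walkCount n x (suc y) m
  g m = if x <ᵇ y then walkCount n (suc x) (suc y) m else 0

length-concatMap-applyUpTo : ∀ {A B : Set} (F : A → List B) f M →
  length (concatMap F (applyUpTo f M)) ≡ ∑[ m < M ] length (F (f (toℕ m)))
length-concatMap-applyUpTo F f zero    = refl
length-concatMap-applyUpTo F f (suc M) =
  trans (length-++ (F (f 0))) (cong (length (F (f 0)) +_) (length-concatMap-applyUpTo F (f ∘ suc) M))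

s≡paths : ∀ n → s n ≡ paths n 0 0 (suc (2 * n))
s≡paths n = begin
  s n
    ≡⟨ length-concatMap-applyUpTo (λ m → filter (λ w → walk n 0 0 w ≟ᵇ true) (words m)) id (suc (2 * n)) ⟩
  ∑[ m < suc (2 * n) ] length (filter (λ w → walk n 0 0 w ≟ᵇ true) (words (toℕ m)))
    ≡⟨ sum-cong-≗ {suc (2 * n)} (λ m → length-filter (walk n 0 0) (words (toℕ m))) ⟩
  ∑[ m < suc (2 * n) ] walkCount n 0 0 (toℕ m)
    ≡⟨ ∑-walkCount n 0 0 (suc (2 * n)) ⟩
  paths n 0 0 (suc (2 * n)) ∎

∧-falseʳ : ∀ b {c} → c ≡ false → b ∧ c ≡ false
∧-falseʳ true  eq = eq
∧-falseʳ false eq = refl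

if-eta : ∀ b → (if b then 0 else 0) ≡ 0
if-eta true  = refl
if-eta false = refl

-- No step lowers `y`. This removes the N- and D-branches once the final ordinate is reached.
paths-overshoot : ∀ M {n x y} → n < y → paths n x y M ≡ 0
paths-overshoot zero    n<y = refl
paths-overshoot (suc M) {n} {x} {y} n<y
  rewrite ∧-falseʳ (x ≡ᵇ n) (dec-false (y ≟ n) (>⇒≢ n<y))
        | paths-overshoot M {n} {suc x} n<y
        | paths-overshoot M {n} {x} {suc y} (m<n⇒m<1+n n<y)
        | paths-overshoot M {n} {suc x} {suc y} (m<n⇒m<1+n n<y)
        | if-eta (x <ᵇ y) = refl

paths-value-fuel : ∀ r → suc (r + r + 1) ≡ suc (r + suc r + 0)
paths-value-fuel = solve-∀

-- A path from (x , x + h) to (x + h + r , x + h + r) has at most 2 r + h steps.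
paths-value : ∀ M {n x y} h r → h + x ≡ y → r + y ≡ n → r + r + h < M → paths n x y M ≡ K h 1 r
paths-value (suc M) {x = x} zero zero refl refl _
  rewrite dec-true (x ≟ x) refl | dec-false (x <? x) (n≮n x)
        | paths-overshoot M {x} {x} {suc x} ≤-refl = refl
paths-value (suc M) {x = x} zero (suc r) refl refl (s≤s lt)
  rewrite ∧-falseʳ (x ≡ᵇ suc (r + x)) (dec-false (x ≟ suc (r + x)) (<⇒≢ (s≤s (m≤n+m x r))))
        | dec-false (x <? x) (n≮n x)
        | paths-value M {x = x} {y = suc x} 1 r refl (+-suc r x) (≤-trans (≤-reflexive (paths-value-fuel r)) lt)
        = +-identityʳ _
paths-value (suc M) {x = x} (suc h) zero refl refl (s≤s lt)
  rewrite dec-false (x ≟ suc (h + x)) (<⇒≢ (s≤s (m≤n+m x h)))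
        | dec-true (x <? suc (h + x)) (s≤s (m≤n+m x h))
        | paths-overshoot M {suc (h + x)} {x} {2 + (h + x)} ≤-refl
        | paths-overshoot M {suc (h + x)} {suc x} {2 + (h + x)} ≤-refl
        = trans (+-identityʳ _) (paths-value M h zero (+-suc h x) refl lt)
paths-value (suc M) {x = x} (suc h) (suc r) refl refl (s≤s lt)
  rewrite ∧-falseʳ (x ≡ᵇ suc (r + suc (h + x)))
            (dec-false (suc (h + x) ≟ suc (r + suc (h + x))) (<⇒≢ (s≤s (m≤n+m (suc (h + x)) r))))
        | dec-true (x <? suc (h + x)) (s≤s (m≤n+m x h)) = begin
  _ ≡⟨ cong₂ _+_
         (paths-value M h (suc r) (+-suc h x) refl
           (≤-trans (≤-reflexive (sym (+-suc (suc (r + suc r)) h))) lt))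
         (cong₂ _+_
           (paths-value M (2 + h) r refl (+-suc r _)
             (≤-trans (≤-reflexive (rearrange r h)) lt))
           -- A D-step lowers 2r + h by two but uses only one unit of fuel, hence the slack `n≤1+n`.
           (paths-value M (suc h) r (cong suc (+-suc h x)) (+-suc r _)
             (≤-trans (s≤s (≤-trans (n≤1+n _) (≤-reflexive (suc-injective (rearrange′ r h))))) lt))) ⟩
  K h 1 (suc r) + (K (2 + h) 1 r + K (suc h) 1 r) ≡⟨ K-step h r ⟨
  K (suc h) 1 (suc r) ∎
  where
  rearrange : ∀ r h → suc (r + r + (2 + h)) ≡ suc (r + suc r + suc h)
  rearrange = solve-∀
  rearrange′ : ∀ r h → suc (suc (r + r + suc h)) ≡ suc (r + suc r + suc h)
  rearrange′ = solve-∀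

s≡K : ∀ n → s n ≡ K 0 1 n
s≡K n = trans (s≡paths n)
  (paths-value (suc (2 * n)) 0 n refl (+-identityʳ n) (s≤s (≤-reflexive (+-assoc n n 0))))

-- Lagrange inversion

-- c a b i is the coefficient of u^i in (1 + u)^a (1 + 2u)^b.
c : ℕ → ℕ → ℕ → ℕ
c a       b       zero    = 1
c zero    zero    (suc i) = 0
c zero    (suc b) (suc i) = c zero b (suc i) + 2 * c zero b i
c (suc a) b       (suc i) = c a b (suc i) + c a b i

-- The clauses of `c` split off a factor 1 + 2u only when a = 0; induction on `a` carries this past
-- the factors 1 + u.
c-sucʳ : ∀ a b i → c a (suc b) (suc i) ≡ c a b (suc i) + 2 * c a b i
c-sucʳ zero    b i       = refl
c-sucʳ (suc a) b zero    rewrite c-sucʳ a b 0 = rearrange (c a b 1)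
  where
  rearrange : ∀ x → x + 2 + 1 ≡ x + 1 + 2
  rearrange = solve-∀
c-sucʳ (suc a) b (suc i) rewrite c-sucʳ a b (suc i) | c-sucʳ a b i =
  rearrange (c a b (2 + i)) (c a b (suc i)) (c a b i)
  where
  rearrange : ∀ x y z → x + 2 * y + (y + 2 * z) ≡ x + y + 2 * (y + z)
  rearrange = solve-∀

*-c-predˡ : ∀ a b i → a * c a b (suc i) ≡ a * (c (pred a) b (suc i) + c (pred a) b i)
*-c-predˡ zero    b i = refl
*-c-predˡ (suc a) b i = refl

*-c-predʳ : ∀ a b i → b * c a b (suc i) ≡ b * (c a (pred b) (suc i) + 2 * c a (pred b) i)
*-c-predʳ a zero    i = refl
*-c-predʳ a (suc b) i = cong (suc b *_) (c-sucʳ a b i)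

-- Coefficient of u^i in ((1 + u)^a (1 + 2u)^b)′; the junk value pred 0 = 0 is
-- always multiplied by 0.
c-derivative : ∀ a b i →
  suc i * c a b (suc i) ≡ a * c (pred a) b i + 2 * (b * c a (pred b) i)
c-derivative zero zero i = *-zeroʳ i
c-derivative zero (suc b) zero rewrite +-identityʳ (c 0 b 1 + 2) | sym (+-identityʳ (c 0 b 1)) | c-derivative zero b zero =
  rearrange b
  where
  rearrange : ∀ b → 2 * (b * 1) + 2 ≡ 2 * (suc b * 1)
  rearrange = solve-∀
c-derivative zero (suc b) (suc i) = begin
  (2 + i) * (c 0 b (2 + i) + 2 * c 0 b (suc i))
    ≡⟨ expand i (c 0 b (2 + i)) (c 0 b (suc i)) ⟩
  (2 + i) * c 0 b (2 + i) + 2 * (suc i * c 0 b (suc i)) + 2 * c 0 b (suc i)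
    ≡⟨ cong₂ (λ x y → x + 2 * y + 2 * c 0 b (suc i)) (c-derivative zero b (suc i)) (c-derivative zero b i) ⟩
  2 * (b * c 0 (pred b) (suc i)) + 2 * (2 * (b * c 0 (pred b) i)) + 2 * c 0 b (suc i)
    ≡⟨ collect b (c 0 (pred b) (suc i)) (c 0 (pred b) i) (c 0 b (suc i)) ⟩
  2 * (c 0 b (suc i) + b * (c 0 (pred b) (suc i) + 2 * c 0 (pred b) i))
    ≡⟨ cong (λ x → 2 * (c 0 b (suc i) + x)) (*-c-predʳ 0 b i) ⟨
  2 * (suc b * c 0 b (suc i)) ∎
  where
  expand : ∀ i x y → (2 + i) * (x + 2 * y) ≡ (2 + i) * x + 2 * (suc i * y) + 2 * y
  expand = solve-∀
  collect : ∀ b x y z → 2 * (b * x) + 2 * (2 * (b * y)) + 2 * z ≡ 2 * (z + b * (x + 2 * y))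
  collect = solve-∀
c-derivative (suc a) b zero = begin
  1 * (c a b 1 + 1)                    ≡⟨ *-distribˡ-+ 1 (c a b 1) 1 ⟩
  1 * c a b 1 + 1                      ≡⟨ cong (_+ 1) (c-derivative a b zero) ⟩
  a * 1 + 2 * (b * 1) + 1              ≡⟨ collect a b ⟩
  suc a * 1 + 2 * (b * 1)              ∎
  where
  collect : ∀ a b → a * 1 + 2 * (b * 1) + 1 ≡ suc a * 1 + 2 * (b * 1)
  collect = solve-∀
c-derivative (suc a) b (suc i) = begin
  (2 + i) * (c a b (2 + i) + c a b (suc i))
    ≡⟨ expand i (c a b (2 + i)) (c a b (suc i)) ⟩
  (2 + i) * c a b (2 + i) + suc i * c a b (suc i) + c a b (suc i)
    ≡⟨ cong₂ (λ x y → x + y + c a b (suc i)) (c-derivative a b (suc i)) (c-derivative a b i) ⟩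
  (a * c (pred a) b (suc i) + 2 * (b * c a (pred b) (suc i))) +
    (a * c (pred a) b i + 2 * (b * c a (pred b) i)) + c a b (suc i)
    ≡⟨ collect a b (c (pred a) b (suc i)) (c a (pred b) (suc i)) (c (pred a) b i) (c a (pred b) i) (c a b (suc i)) ⟩
  c a b (suc i) + a * (c (pred a) b (suc i) + c (pred a) b i) +
    2 * (b * (c a (pred b) (suc i) + c a (pred b) i))
    ≡⟨ cong (λ x → c a b (suc i) + x + 2 * (b * (c a (pred b) (suc i) + c a (pred b) i))) (*-c-predˡ a b i) ⟨
  suc a * c a b (suc i) + 2 * (b * c (suc a) (pred b) (suc i)) ∎
  where
  expand : ∀ i x y → (2 + i) * (x + y) ≡ (2 + i) * x + suc i * y + y
  expand = solve-∀
  collect : ∀ a b x y z w v →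
    (a * x + 2 * (b * y)) + (a * z + 2 * (b * w)) + v ≡ v + a * (x + z) + 2 * (b * (y + w))
  collect = solve-∀

-- Lagrange inversion for U = S - 1 = x φ(U), φ(u) = (1 + u)(1 + 2u), in the form
-- [x^n] H(U) = [u^n] H φ^(n-1) (φ - u φ'), for H = (1 + 2u)^h (1 + u)^k.
K-lagrange : ∀ {a b} h k m → a ≡ k + m → b ≡ h + m →
  K h k (suc m) + (c a (suc b) m + 2 * c (suc a) b m) ≡ c (suc a) (suc b) (suc m)
-- For H = 1 the claim is (φ^(m+1))' = (m + 1) φ^m φ' in degree m, with the factor m + 1 cancelled.
K-lagrange zero zero m refl refl = sym (*-cancelˡ-≡ _ _ (suc m) (begin
  suc m * c (suc m) (suc m) (suc m)
    ≡⟨ c-derivative (suc m) (suc m) m ⟩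
  suc m * c m (suc m) m + 2 * (suc m * c (suc m) m m)
    ≡⟨ collect m (c m (suc m) m) (c (suc m) m m) ⟩
  suc m * (c m (suc m) m + 2 * c (suc m) m m)
    ≡⟨ cong (λ x → suc m * (x + (c m (suc m) m + 2 * c (suc m) m m))) (K00 m) ⟨
  suc m * (K 0 0 (suc m) + (c m (suc m) m + 2 * c (suc m) m m)) ∎))
  where
  K00 : ∀ m → K 0 0 (suc m) ≡ 0
  K00 m = refl
  collect : ∀ m x y → suc m * x + 2 * (suc m * y) ≡ suc m * (x + 2 * y)
  collect = solve-∀
K-lagrange zero (suc k) zero refl refl
  rewrite sym (K-lagrange zero k zero refl refl) = rearrange (K 0 k 1)
  where
  rearrange : ∀ x → x + 1 + 3 ≡ x + 3 + 1
  rearrange = solve-∀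
K-lagrange zero (suc k) (suc m) refl refl = begin
  K 0 k (2 + m) + κ +
    (c a (suc b) (suc m) + c a (suc b) m + 2 * (c (suc a) b (suc m) + c (suc a) b m))
    ≡⟨ rearrange (K 0 k (2 + m)) κ (c a (suc b) (suc m)) (c a (suc b) m) (c (suc a) b (suc m)) (c (suc a) b m) ⟩
  K 0 k (2 + m) + (c a (suc b) (suc m) + 2 * c (suc a) b (suc m)) +
    (κ + (c a (suc b) m + 2 * c (suc a) b m))
    -- The second term is read one degree lower, but L S = φ(U) adds a factor φ to its H. So H
    -- φ^(n-1), and with it `a` and `b`, is the same in both calls.
    ≡⟨ cong₂ _+_ (K-lagrange zero k (suc m) refl refl) (K-lagrange 1 (suc k) m (+-suc k m) refl) ⟩
  c (2 + a) (suc b) (2 + m) ∎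
  where
  a = k + suc m
  b = suc m
  κ = K 1 (suc k) (suc m)
  rearrange : ∀ x y p q r t →
    x + y + (p + q + 2 * (r + t)) ≡ x + (p + 2 * r) + (y + (q + 2 * t))
  rearrange = solve-∀
K-lagrange (suc h) k zero refl refl
  rewrite c-sucʳ (suc (k + 0)) (suc (h + 0)) 0
        | sym (K-lagrange h k zero refl refl) = rearrange (K h k 1)
  where
  rearrange : ∀ x → x + 2 + 3 ≡ x + 3 + 2
  rearrange = solve-∀
K-lagrange (suc h) k (suc m) refl refl = begin
  K h k (2 + m) + 2 * κ + (c a (2 + b) (suc m) + 2 * c (suc a) (suc b) (suc m))
    ≡⟨ cong₂ (λ x y → K h k (2 + m) + 2 * κ + (x + 2 * y)) (c-sucʳ a (suc b) m) (c-sucʳ (suc a) b m) ⟩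
  K h k (2 + m) + 2 * κ +
    (c a (suc b) (suc m) + 2 * c a (suc b) m + 2 * (c (suc a) b (suc m) + 2 * c (suc a) b m))
    ≡⟨ rearrange (K h k (2 + m)) κ (c a (suc b) (suc m)) (c a (suc b) m) (c (suc a) b (suc m)) (c (suc a) b m) ⟩
  K h k (2 + m) + (c a (suc b) (suc m) + 2 * c (suc a) b (suc m)) +
    2 * (κ + (c a (suc b) m + 2 * c (suc a) b m))
    ≡⟨ cong₂ (λ x y → x + 2 * y) (K-lagrange h k (suc m) refl refl)
         (K-lagrange (suc h) (suc k) m (+-suc k m) (+-suc h m)) ⟩
  c (suc a) (suc b) (2 + m) + 2 * c (suc a) (suc b) (suc m)
    ≡⟨ c-sucʳ (suc a) (suc b) (suc m) ⟨
  c (suc a) (2 + b) (2 + m) ∎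
  where
  a = k + suc m
  b = h + suc m
  κ = K (suc h) (suc k) (suc m)
  rearrange : ∀ x y p q r t →
    x + 2 * y + (p + 2 * q + 2 * (r + 2 * t)) ≡ x + (p + 2 * r) + 2 * (y + (q + 2 * t))
  rearrange = solve-∀

-- After multiplying `K-lagrange` by m + 1, the right side is a derivative whose factor 1 + u has
-- exponent k + m + 1. Its surplus k over m + 1 is all that survives the cancellation.
K-closed : ∀ k m → suc m * K 0 k (suc m) ≡ k * c (k + m) (suc m) m
K-closed k m = +-cancelʳ-≡ (suc m * X + 2 * (suc m * Y)) _ _ (begin
  suc m * K 0 k (suc m) + (suc m * X + 2 * (suc m * Y))
    ≡⟨ collect m (K 0 k (suc m)) X Y ⟩
  suc m * (K 0 k (suc m) + (X + 2 * Y))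
    ≡⟨ cong (suc m *_) (K-lagrange 0 k m refl refl) ⟩
  suc m * c (suc (k + m)) (suc m) (suc m)
    ≡⟨ c-derivative (suc (k + m)) (suc m) m ⟩
  suc (k + m) * X + 2 * (suc m * Y)
    ≡⟨ expand k m X Y ⟩
  k * X + (suc m * X + 2 * (suc m * Y)) ∎)
  where
  X = c (k + m) (suc m) m
  Y = c (suc (k + m)) m m
  collect : ∀ m z x y → suc m * z + (suc m * x + 2 * (suc m * y)) ≡ suc m * (z + (x + 2 * y))
  collect = solve-∀
  expand : ∀ k m x y → suc (k + m) * x + 2 * (suc m * y) ≡ k * x + (suc m * x + 2 * (suc m * y))
  expand = solve-∀

-- Binomial expansion of (1 + u)^a (1 + 2u)^b

-- (1 + E)^b applied to y at 0, where E is the shift operator.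
shiftSum : ℕ → (ℕ → ℕ) → ℕ
shiftSum zero    y = y 0
shiftSum (suc b) y = shiftSum b y + shiftSum b (y ∘ suc)

shiftSum-cong : ∀ b {y z} → (∀ j → y j ≡ z j) → shiftSum b y ≡ shiftSum b z
shiftSum-cong zero    eq = eq 0
shiftSum-cong (suc b) eq = cong₂ _+_ (shiftSum-cong b eq) (shiftSum-cong b (eq ∘ suc))

shiftSum-C-vanish : ∀ a b p → a + b < p → shiftSum b (λ j → (a + j) C p) ≡ 0
shiftSum-C-vanish a zero    p lt = k>n⇒nCk≡0 lt
shiftSum-C-vanish a (suc b) p lt = cong₂ _+_
  (shiftSum-C-vanish a b p (<-trans (≤-reflexive (sym (+-suc a b))) lt))
  (trans (shiftSum-cong b (λ j → cong (_C p) (+-suc a j)))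
    (shiftSum-C-vanish (suc a) b p (subst (_< p) (+-suc a b) lt)))

c-binomial : ∀ a i → c a 0 i ≡ a C i
c-binomial zero    zero    = refl
c-binomial zero    (suc i) = refl
c-binomial (suc a) zero    = refl
c-binomial (suc a) (suc i) = begin
  c a 0 (suc i) + c a 0 i ≡⟨ cong₂ _+_ (c-binomial a (suc i)) (c-binomial a i) ⟩
  a C suc i + a C i       ≡⟨ +-comm (a C suc i) _ ⟩
  a C i + a C suc i       ≡⟨ nCk+nC[k+1]≡[n+1]C[k+1] a i ⟩
  suc a C suc i           ∎

-- (1 + u)^a (1 + 2u)^b = Σ_j C(b,j) (1 + u)^(a+j) u^(b-j), with C(a+j, i-b+j)
-- written by symmetry as C(a+j, p).
c-shiftSum : ∀ b a i p → p + i ≡ a + b → c a b i ≡ shiftSum b (λ j → (a + j) C p)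
c-shiftSum zero a i p eq = begin
  c a 0 i     ≡⟨ c-binomial a i ⟩
  a C i       ≡⟨ nCk≡nC[n∸k] (m+n≤o⇒n≤o p (≤-reflexive eq′)) ⟩
  a C (a ∸ i) ≡⟨ cong (a C_) (trans (cong (_∸ i) (sym eq′)) (m+n∸n≡m p i)) ⟩
  a C p       ≡⟨ cong (_C p) (+-identityʳ a) ⟨
  (a + 0) C p ∎
  where
  eq′ : p + i ≡ a
  eq′ = trans eq (+-identityʳ a)
c-shiftSum (suc b) a zero p eq = sym (begin
  shiftSum b (λ j → (a + j) C p) + shiftSum b (λ j → (a + suc j) C p)
    -- Here p = a + b + 1, so the binomials with upper index at most a + b vanish; the single one
    -- that remains lies in the shifted half.
    ≡⟨ cong₂ _+_ (shiftSum-C-vanish a b p (≤-reflexive (trans (sym (+-suc a b)) (trans (sym eq) (+-identityʳ p)))))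
         (shiftSum-cong b (λ j → cong (_C p) (+-suc a j))) ⟩
  shiftSum b (λ j → (suc a + j) C p)
    ≡⟨ c-shiftSum b (suc a) zero p (trans eq (+-suc a b)) ⟨
  1 ∎)
c-shiftSum (suc b) a (suc i) p eq = begin
  c a (suc b) (suc i)
    ≡⟨ c-sucʳ a b i ⟩
  c a b (suc i) + 2 * c a b i
    -- This is 1 + 2u = u + (1 + u). Both parts satisfy the hypothesis with the same `p`, so the
    -- lower index never moves.
    ≡⟨ rearrange (c a b (suc i)) (c a b i) ⟩
  c a b i + c (suc a) b (suc i)
    ≡⟨ cong₂ _+_ (c-shiftSum b a i p (suc-injective (trans (sym (+-suc p i)) (trans eq (+-suc a b)))))
         (c-shiftSum b (suc a) (suc i) p (trans eq (+-suc a b))) ⟩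
  shiftSum b (λ j → (a + j) C p) + shiftSum b (λ j → (suc a + j) C p)
    ≡⟨ cong (shiftSum b (λ j → (a + j) C p) +_) (shiftSum-cong b (λ j → cong (_C p) (+-suc a j))) ⟨
  shiftSum (suc b) (λ j → (a + j) C p) ∎
  where
  rearrange : ∀ x y → x + 2 * y ≡ y + (x + y)
  rearrange = solve-∀

-- Sums of rationals

ℚ-ring : AlmostCommutativeRing _ _
ℚ-ring = fromCommutativeRing ℚ.+-*-commutativeRing (λ _ → nothing)

ι : ℕ → ℚ
ι n = (pos n) /ℚ 1

inv : (n : ℕ) → .{{NonZero n}} → ℚ
inv n = (pos 1) /ℚ n

-- A quotient `pos m /ℚ suc n` unfolds to `fromℚᵘ` of an unreduced fraction. Transporting the
-- operations along `fromℚᵘ` lets identities be checked by cross-multiplication, without gcds.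
fromℚᵘ-+ : ∀ p q → fromℚᵘ (p ℚᵘ.+ q) ≡ fromℚᵘ p +ℚ fromℚᵘ q
fromℚᵘ-+ p q = ℚ.toℚᵘ-injective (ℚᵘ.≃-trans (ℚ.toℚᵘ-fromℚᵘ (p ℚᵘ.+ q)) (ℚᵘ.≃-sym
  (ℚᵘ.≃-trans (ℚ.toℚᵘ-homo-+ (fromℚᵘ p) (fromℚᵘ q))
    (ℚᵘ.+-cong (ℚ.toℚᵘ-fromℚᵘ p) (ℚ.toℚᵘ-fromℚᵘ q)))))

fromℚᵘ-* : ∀ p q → fromℚᵘ (p ℚᵘ.* q) ≡ fromℚᵘ p *ℚ fromℚᵘ q
fromℚᵘ-* p q = ℚ.toℚᵘ-injective (ℚᵘ.≃-trans (ℚ.toℚᵘ-fromℚᵘ (p ℚᵘ.* q)) (ℚᵘ.≃-sym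
  (ℚᵘ.≃-trans (ℚ.toℚᵘ-homo-* (fromℚᵘ p) (fromℚᵘ q))
    (ℚᵘ.*-cong (ℚ.toℚᵘ-fromℚᵘ p) (ℚ.toℚᵘ-fromℚᵘ q)))))

ι-+ : ∀ m n → ι (m + n) ≡ ι m +ℚ ι n
ι-+ m n = trans
  (cong (_/ℚ 1) (trans (ℤ.pos-+ m n) (sym (cong₂ ℤ._+_ (ℤ.*-identityʳ (pos m)) (ℤ.*-identityʳ (pos n))))))
  (fromℚᵘ-+ (mkℚᵘ (pos m) 0) (mkℚᵘ (pos n) 0))

ι-* : ∀ m n → ι (m * n) ≡ ι m *ℚ ι n
ι-* m n = trans (cong (_/ℚ 1) (ℤ.pos-* m n)) (fromℚᵘ-* (mkℚᵘ (pos m) 0) (mkℚᵘ (pos n) 0))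

/-inv : ∀ m n .{{_ : NonZero n}} → (pos m) /ℚ n ≡ ι m *ℚ inv n
/-inv m (suc n) = trans
  (ℚ.fromℚᵘ-cong {mkℚᵘ (pos m) n} {mkℚᵘ (pos m) 0 ℚᵘ.* mkℚᵘ (pos 1) n}
    (*≡* (cong₂ ℤ._*_ (sym (ℤ.*-identityʳ (pos m))) (cong (λ x → pos (suc x)) (+-identityʳ n)))))
  (fromℚᵘ-* (mkℚᵘ (pos m) 0) (mkℚᵘ (pos 1) n))

ι-inv : ∀ n .{{_ : NonZero n}} → ι n *ℚ inv n ≡ 1ℚ
ι-inv (suc n) = trans (sym (/-inv (suc n) (suc n)))
  (ℚ.fromℚᵘ-cong {mkℚᵘ (pos (suc n)) n} {mkℚᵘ (pos 1) 0}
    (*≡* (trans (ℤ.*-identityʳ (pos (suc n))) (sym (ℤ.*-identityˡ (pos (suc n)))))))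

solve-for : ∀ n .{{_ : NonZero n}} {x y} → ι n *ℚ x ≡ y → x ≡ inv n *ℚ y
solve-for n {x} {y} eq = begin
  x                      ≡⟨ ℚ.*-identityˡ x ⟨
  1ℚ *ℚ x                ≡⟨ cong (_*ℚ x) (ι-inv n) ⟨
  ι n *ℚ inv n *ℚ x      ≡⟨ rearrange (ι n) (inv n) x ⟩
  inv n *ℚ (ι n *ℚ x)    ≡⟨ cong (inv n *ℚ_) eq ⟩
  inv n *ℚ y             ∎
  where
  rearrange : ∀ a b x → a *ℚ b *ℚ x ≡ b *ℚ (a *ℚ x)
  rearrange = solve-∀-in ℚ-ring

inv-* : ∀ m n .{{_ : NonZero m}} .{{_ : NonZero n}} .{{_ : NonZero (m * n)}} →
        inv (m * n) ≡ inv m *ℚ inv n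
inv-* m n = sym (trans (solve-for (m * n) eq) (ℚ.*-identityʳ _))
  where
  rearrange : ∀ a b c d → a *ℚ b *ℚ (c *ℚ d) ≡ (a *ℚ c) *ℚ (b *ℚ d)
  rearrange = solve-∀-in ℚ-ring
  eq : ι (m * n) *ℚ (inv m *ℚ inv n) ≡ 1ℚ
  eq = begin
    ι (m * n) *ℚ (inv m *ℚ inv n)         ≡⟨ cong (_*ℚ (inv m *ℚ inv n)) (ι-* m n) ⟩
    ι m *ℚ ι n *ℚ (inv m *ℚ inv n)        ≡⟨ rearrange (ι m) (ι n) (inv m) (inv n) ⟩
    (ι m *ℚ inv m) *ℚ (ι n *ℚ inv n)      ≡⟨ cong₂ _*ℚ_ (ι-inv m) (ι-inv n) ⟩
    1ℚ *ℚ 1ℚ                              ≡⟨⟩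
    1ℚ                                    ∎

∑ℚ : ℕ → (ℕ → ℚ) → ℚ
∑ℚ n f = Sumℚ.sum {n} (f ∘ toℕ)

∑ℚ-cong : ∀ n {f g} → (∀ t → t < n → f t ≡ g t) → ∑ℚ n f ≡ ∑ℚ n g
∑ℚ-cong n eq = Sumℚ.sum-cong-≗ {n} (λ t → eq (toℕ t) (toℕ<n t))

∑ℚ-+ : ∀ n f g → ∑ℚ n (λ t → f t +ℚ g t) ≡ ∑ℚ n f +ℚ ∑ℚ n g
∑ℚ-+ n f g = Sumℚ.∑-distrib-+ {n} (f ∘ toℕ) (g ∘ toℕ)

∑ℚ-*ˡ : ∀ n x f → x *ℚ ∑ℚ n f ≡ ∑ℚ n (λ t → x *ℚ f t)
∑ℚ-*ˡ n x f = Sumℚ.*-distribˡ-sum {n} x (f ∘ toℕ)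

∑ℚ-comm : ∀ m n (f : ℕ → ℕ → ℚ) → ∑ℚ m (λ i → ∑ℚ n (f i)) ≡ ∑ℚ n (λ j → ∑ℚ m (λ i → f i j))
∑ℚ-comm m n f = Sumℚ.∑-comm {m} {n} (λ i j → f (toℕ i) (toℕ j))

∑ℚ-last : ∀ n f → ∑ℚ (suc n) f ≡ ∑ℚ n f +ℚ f n
∑ℚ-last n f = trans (Sumℚ.sum-init-last {n} (f ∘ toℕ))
  (cong₂ _+ℚ_ (Sumℚ.sum-cong-≗ {n} (λ t → cong f (toℕ-inject₁ t))) (cong f (toℕ-fromℕ n)))

∑ℚ-zero : ∀ n {f} → (∀ t → f t ≡ 0ℚ) → ∑ℚ n f ≡ 0ℚ
∑ℚ-zero n eq = trans (Sumℚ.sum-cong-≗ {n} (eq ∘ toℕ)) (Sumℚ.sum-replicate-zero n)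

∑ᴸ : ∀ {A : Set} → (A → ℚ) → List A → ℚ
∑ᴸ f xs = sumℚ (map f xs)

∑ᴸ-cong : ∀ {A : Set} {f g : A → ℚ} → (∀ x → f x ≡ g x) → ∀ xs → ∑ᴸ f xs ≡ ∑ᴸ g xs
∑ᴸ-cong eq []       = refl
∑ᴸ-cong eq (x ∷ xs) = cong₂ _+ℚ_ (eq x) (∑ᴸ-cong eq xs)

∑ᴸ-+ : ∀ {A : Set} (f g : A → ℚ) xs → ∑ᴸ (λ x → f x +ℚ g x) xs ≡ ∑ᴸ f xs +ℚ ∑ᴸ g xs
∑ᴸ-+ f g []       = refl
∑ᴸ-+ f g (x ∷ xs) rewrite ∑ᴸ-+ f g xs = rearrange (f x) (g x) (∑ᴸ f xs) (∑ᴸ g xs)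
  where
  rearrange : ∀ a b c d → a +ℚ b +ℚ (c +ℚ d) ≡ a +ℚ c +ℚ (b +ℚ d)
  rearrange = solve-∀-in ℚ-ring

∑ᴸ-*ˡ : ∀ {A : Set} r (f : A → ℚ) xs → ∑ᴸ (λ x → r *ℚ f x) xs ≡ r *ℚ ∑ᴸ f xs
∑ᴸ-*ˡ r f []       = sym (ℚ.*-zeroʳ r)
∑ᴸ-*ˡ r f (x ∷ xs) = trans (cong (r *ℚ f x +ℚ_) (∑ᴸ-*ˡ r f xs)) (sym (ℚ.*-distribˡ-+ r (f x) _))

∑ᴸ-++ : ∀ {A : Set} (f : A → ℚ) xs ys → ∑ᴸ f (xs ++ ys) ≡ ∑ᴸ f xs +ℚ ∑ᴸ f ys
∑ᴸ-++ f []       ys = sym (ℚ.+-identityˡ _)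
∑ᴸ-++ f (x ∷ xs) ys = trans (cong (f x +ℚ_) (∑ᴸ-++ f xs ys)) (sym (ℚ.+-assoc (f x) _ _))

∑ᴸ-concatMap-applyUpTo : ∀ {A B : Set} (f : B → ℚ) (F : A → List B) (g : ℕ → A) n →
  ∑ᴸ f (concatMap F (applyUpTo g n)) ≡ ∑ℚ n (λ t → ∑ᴸ f (F (g t)))
∑ᴸ-concatMap-applyUpTo f F g zero    = refl
∑ᴸ-concatMap-applyUpTo f F g (suc n) = trans (∑ᴸ-++ f (F (g 0)) _)
  (cong (∑ᴸ f (F (g 0)) +ℚ_) (∑ᴸ-concatMap-applyUpTo f F (g ∘ suc) n))

-- Partial Bell polynomials as sums over boxes

-- Each 1/αᵢ! is moved next to its own power, so the summand is a product over coordinates and a box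
-- sum can be peeled one exponent at a time.
weight : (ℕ → ℚ) → ∀ {l} → ℕ → Vec ℕ l → ℚ
weight w i []      = 1ℚ
weight w i (a ∷ v) = ((w i ^ℚ a) *ℚ inv (a !) {{a !≢0}}) *ℚ weight w (suc i) v

divided : (ℕ → ℚ) → ℕ → ℚ
divided z i = z i *ℚ inv (i !) {{i !≢0}}

∏z-weight : ∀ z {l} i (v : Vec ℕ l) →
  inv (∏α! v) {{∏α!≢0 v}} *ℚ ∏z z i v ≡ weight (divided z) i v
∏z-weight z i []      = refl
∏z-weight z i (a ∷ v) = begin
  inv (a ! * ∏α! v) {{∏α!≢0 (a ∷ v)}} *ℚ (x *ℚ ∏z z (suc i) v)
    ≡⟨ cong (_*ℚ (x *ℚ ∏z z (suc i) v)) (inv-* (a !) (∏α! v) {{a !≢0}} {{∏α!≢0 v}} {{∏α!≢0 (a ∷ v)}}) ⟩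
  inv (a !) {{a !≢0}} *ℚ inv (∏α! v) {{∏α!≢0 v}} *ℚ (x *ℚ ∏z z (suc i) v)
    ≡⟨ rearrange (inv (a !) {{a !≢0}}) (inv (∏α! v) {{∏α!≢0 v}}) x (∏z z (suc i) v) ⟩
  (x *ℚ inv (a !) {{a !≢0}}) *ℚ (inv (∏α! v) {{∏α!≢0 v}} *ℚ ∏z z (suc i) v)
    ≡⟨ cong ((x *ℚ inv (a !) {{a !≢0}}) *ℚ_) (∏z-weight z (suc i) v) ⟩
  weight (divided z) i (a ∷ v) ∎
  where
  x = divided z i ^ℚ a
  rearrange : ∀ a b c d → a *ℚ b *ℚ (c *ℚ d) ≡ (c *ℚ a) *ℚ (b *ℚ d)
  rearrange = solve-∀-in ℚ-ring

bellTerm-weight : ∀ n z {l} (v : Vec ℕ l) →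
  bellTerm n z v ≡ ι (n !) *ℚ weight (divided z) 1 v
bellTerm-weight n z v = begin
  (pos (n !) /ℚ ∏α! v) {{∏α!≢0 v}} *ℚ ∏z z 1 v
    ≡⟨ cong (_*ℚ ∏z z 1 v) (/-inv (n !) (∏α! v) {{∏α!≢0 v}}) ⟩
  ι (n !) *ℚ inv (∏α! v) {{∏α!≢0 v}} *ℚ ∏z z 1 v
    ≡⟨ ℚ.*-assoc (ι (n !)) _ _ ⟩
  ι (n !) *ℚ (inv (∏α! v) {{∏α!≢0 v}} *ℚ ∏z z 1 v)
    ≡⟨ cong (ι (n !) *ℚ_) (∏z-weight z 1 v) ⟩
  ι (n !) *ℚ weight (divided z) 1 v ∎

-- Sums over the exponent vectors in {0..b}^l of weighted test functions of
-- (Σ α, Σ i α); testing against δ k n selects the partial Bell polynomial.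
boxSum : (ℕ → ℚ) → (l b i : ℕ) → (ℕ → ℕ → ℚ) → ℚ
boxSum w l b i φ = ∑ᴸ (λ v → weight w i v *ℚ φ (Σα v) (Σiα i v)) (boxVecs l b)

δ : ℕ → ℕ → ℕ → ℕ → ℚ
δ k n k′ n′ = if (k′ ≡ᵇ k) ∧ (n′ ≡ᵇ n) then 1ℚ else 0ℚ

∑ᴸ-filter : ∀ {l} (f : Vec ℕ l → ℚ) k n vs →
  ∑ᴸ f (filter (λ α → (Σα α ≟ k) ×-dec (Σiα 1 α ≟ n)) vs)
  ≡ ∑ᴸ (λ v → f v *ℚ δ k n (Σα v) (Σiα 1 v)) vs
∑ᴸ-filter f k n []       = refl
∑ᴸ-filter f k n (v ∷ vs) with Σα v ≡ᵇ k | Σiα 1 v ≡ᵇ n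
... | true  | true  = cong₂ _+ℚ_ (sym (ℚ.*-identityʳ (f v))) (∑ᴸ-filter f k n vs)
... | true  | false = trans (∑ᴸ-filter f k n vs) (sym (trans (cong (_+ℚ _) (ℚ.*-zeroʳ (f v))) (ℚ.+-identityˡ _)))
... | false | _     = trans (∑ᴸ-filter f k n vs) (sym (trans (cong (_+ℚ _) (ℚ.*-zeroʳ (f v))) (ℚ.+-identityˡ _)))

bell-boxSum : ∀ n k z → bell n k z ≡ ι (n !) *ℚ boxSum (divided z) (suc (n ∸ k)) k 1 (δ k n)
bell-boxSum n k z = begin
  bell n k z
    ≡⟨ ∑ᴸ-filter (bellTerm n z) k n (boxVecs (suc (n ∸ k)) k) ⟩
  ∑ᴸ (λ v → bellTerm n z v *ℚ δ k n (Σα v) (Σiα 1 v)) (boxVecs (suc (n ∸ k)) k)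
    ≡⟨ ∑ᴸ-cong (λ v → trans (cong (_*ℚ δ k n (Σα v) (Σiα 1 v)) (bellTerm-weight n z v)) (ℚ.*-assoc (ι (n !)) _ _))
         (boxVecs (suc (n ∸ k)) k) ⟩
  ∑ᴸ (λ v → ι (n !) *ℚ (weight (divided z) 1 v *ℚ δ k n (Σα v) (Σiα 1 v))) (boxVecs (suc (n ∸ k)) k)
    ≡⟨ ∑ᴸ-*ˡ (ι (n !)) _ (boxVecs (suc (n ∸ k)) k) ⟩
  _ ∎

boxSum-cong : ∀ w l b i {φ ψ} → (∀ k n → φ k n ≡ ψ k n) → boxSum w l b i φ ≡ boxSum w l b i ψ
boxSum-cong w l b i eq = ∑ᴸ-cong (λ v → cong (weight w i v *ℚ_) (eq _ _)) (boxVecs l b)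

boxSum-*ˡ : ∀ w l b i r φ → boxSum w l b i (λ k n → r *ℚ φ k n) ≡ r *ℚ boxSum w l b i φ
boxSum-*ˡ w l b i r φ = trans
  (∑ᴸ-cong (λ v → rearrange (weight w i v) r (φ (Σα v) (Σiα i v))) (boxVecs l b))
  (∑ᴸ-*ˡ r _ (boxVecs l b))
  where
  rearrange : ∀ a b c → a *ℚ (b *ℚ c) ≡ b *ℚ (a *ℚ c)
  rearrange = solve-∀-in ℚ-ring

boxSum-+ : ∀ w l b i φ ψ →
  boxSum w l b i (λ k n → φ k n +ℚ ψ k n) ≡ boxSum w l b i φ +ℚ boxSum w l b i ψ
boxSum-+ w l b i φ ψ = trans
  (∑ᴸ-cong (λ v → ℚ.*-distribˡ-+ (weight w i v) _ _) (boxVecs l b))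
  (∑ᴸ-+ _ _ (boxVecs l b))

boxSum-zero : ∀ w l b i {φ} → (∀ k n → φ k n ≡ 0ℚ) → boxSum w l b i φ ≡ 0ℚ
boxSum-zero w l b i {φ} eq = begin
  boxSum w l b i φ                         ≡⟨ boxSum-cong w l b i (λ k n → trans (eq k n) (sym (ℚ.*-zeroˡ 0ℚ))) ⟩
  boxSum w l b i (λ _ _ → 0ℚ *ℚ 0ℚ)        ≡⟨ boxSum-*ˡ w l b i 0ℚ (λ _ _ → 0ℚ) ⟩
  0ℚ *ℚ boxSum w l b i (λ _ _ → 0ℚ)        ≡⟨ ℚ.*-zeroˡ (boxSum w l b i (λ _ _ → 0ℚ)) ⟩
  0ℚ                                       ∎

dividedPower : (ℕ → ℚ) → ℕ → ℕ → ℚ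
dividedPower w i a = (w i ^ℚ a) *ℚ inv (a !) {{a !≢0}}

-- The derivative of w^a/a! in disguise: a multiplicity is traded for the removal of one block.
dividedPower-suc : ∀ w i a → dividedPower w i (suc a) *ℚ ι (suc a) ≡ w i *ℚ dividedPower w i a
dividedPower-suc w i a = begin
  w i *ℚ x *ℚ inv (suc a * a !) {{suc a !≢0}} *ℚ ι (suc a)
    ≡⟨ cong (λ y → w i *ℚ x *ℚ y *ℚ ι (suc a)) (inv-* (suc a) (a !) {{_}} {{a !≢0}} {{suc a !≢0}}) ⟩
  w i *ℚ x *ℚ (inv (suc a) *ℚ y) *ℚ ι (suc a)
    ≡⟨ rearrange (w i) x (inv (suc a)) y (ι (suc a)) ⟩
  ι (suc a) *ℚ inv (suc a) *ℚ (w i *ℚ (x *ℚ y))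
    ≡⟨ cong (_*ℚ (w i *ℚ (x *ℚ y))) (ι-inv (suc a)) ⟩
  1ℚ *ℚ (w i *ℚ (x *ℚ y))
    ≡⟨ ℚ.*-identityˡ _ ⟩
  w i *ℚ (x *ℚ y) ∎
  where
  x = w i ^ℚ a
  y = inv (a !) {{a !≢0}}
  rearrange : ∀ p q r s t → p *ℚ q *ℚ (r *ℚ s) *ℚ t ≡ t *ℚ r *ℚ (p *ℚ (q *ℚ s))
  rearrange = solve-∀-in ℚ-ring

-- Fixing the first exponent merely translates the test function. This is why φ is arbitrary:
-- nothing has to be subtracted from k or n.
boxSum-suc : ∀ w l b i φ → boxSum w (suc l) b i φ ≡
  ∑ℚ (suc b) (λ a → dividedPower w i a *ℚ boxSum w l b (suc i) (λ k n → φ (a + k) (i * a + n)))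
boxSum-suc w l b i φ = trans
  (∑ᴸ-concatMap-applyUpTo g (λ a → map (a ∷_) (boxVecs l b)) id (suc b))
  (∑ℚ-cong (suc b) (λ a _ → begin
    ∑ᴸ g (map (a ∷_) (boxVecs l b))
      ≡⟨ cong sumℚ (map-∘ (boxVecs l b)) ⟨
    ∑ᴸ (g ∘ (a ∷_)) (boxVecs l b)
      ≡⟨ ∑ᴸ-cong (λ v → ℚ.*-assoc (dividedPower w i a) _ _) (boxVecs l b) ⟩
    _ ≡⟨ ∑ᴸ-*ˡ (dividedPower w i a) _ (boxVecs l b) ⟩
    _ ∎))
  where
  g : Vec ℕ (suc l) → ℚ
  g v = weight w i v *ℚ φ (Σα v) (Σiα i v)

-- The Euler identity k B_k = Σ_t w_t (∂/∂w_t) B_k, the derivative ∂/∂w_t removing one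
-- block of size t.
boxSum-euler : ∀ w l b i (φ : ℕ → ℕ → ℚ) → (∀ k n → b < k → φ k n ≡ 0ℚ) →
  boxSum w l b i (λ k n → ι k *ℚ φ k n)
  ≡ ∑ℚ l (λ t → w (t + i) *ℚ boxSum w l b i (λ k n → φ (suc k) (t + i + n)))
boxSum-euler w zero    b i φ supp = cong (_+ℚ 0ℚ) (trans (ℚ.*-identityˡ _) (ℚ.*-zeroˡ (φ 0 0)))
boxSum-euler w (suc l) b i φ supp = begin
  boxSum w (suc l) b i (λ k n → ι k *ℚ φ k n)
    ≡⟨ boxSum-suc w l b i (λ k n → ι k *ℚ φ k n) ⟩
  ∑ℚ (suc b) (λ a → p a *ℚ B (λ k n → ι (a + k) *ℚ φ (a + k) (i * a + n)))
    ≡⟨ ∑ℚ-cong (suc b) (λ a _ → split a) ⟩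
  ∑ℚ (suc b) (λ a → p a *ℚ ι a *ℚ B (φ′ a) +ℚ p a *ℚ B (λ k n → ι k *ℚ φ′ a k n))
    ≡⟨ ∑ℚ-+ (suc b) (λ a → p a *ℚ ι a *ℚ B (φ′ a)) (λ a → p a *ℚ B (λ k n → ι k *ℚ φ′ a k n)) ⟩
  ∑ℚ (suc b) (λ a → p a *ℚ ι a *ℚ B (φ′ a)) +ℚ ∑ℚ (suc b) (λ a → p a *ℚ B (λ k n → ι k *ℚ φ′ a k n))
    ≡⟨ cong₂ _+ℚ_ first-block other-blocks ⟩
  w i *ℚ boxSum w (suc l) b i (λ k n → φ (suc k) (i + n)) +ℚ
    ∑ℚ l (λ t → w (suc t + i) *ℚ boxSum w (suc l) b i (λ k n → φ (suc k) (suc t + i + n))) ∎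
  where
  p : ℕ → ℚ
  p = dividedPower w i
  B : (ℕ → ℕ → ℚ) → ℚ
  B = boxSum w l b (suc i)
  φ′ : ℕ → ℕ → ℕ → ℚ
  φ′ a k n = φ (a + k) (i * a + n)

  split : ∀ a → p a *ℚ B (λ k n → ι (a + k) *ℚ φ′ a k n) ≡
                p a *ℚ ι a *ℚ B (φ′ a) +ℚ p a *ℚ B (λ k n → ι k *ℚ φ′ a k n)
  split a = begin
    p a *ℚ B (λ k n → ι (a + k) *ℚ φ′ a k n)
      ≡⟨ cong (p a *ℚ_) (boxSum-cong w l b (suc i) (λ k n →
           trans (cong (_*ℚ φ′ a k n) (ι-+ a k)) (ℚ.*-distribʳ-+ (φ′ a k n) (ι a) (ι k)))) ⟩
    p a *ℚ B (λ k n → ι a *ℚ φ′ a k n +ℚ ι k *ℚ φ′ a k n)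
      ≡⟨ cong (p a *ℚ_) (boxSum-+ w l b (suc i) (λ k n → ι a *ℚ φ′ a k n) (λ k n → ι k *ℚ φ′ a k n)) ⟩
    p a *ℚ (B (λ k n → ι a *ℚ φ′ a k n) +ℚ B (λ k n → ι k *ℚ φ′ a k n))
      ≡⟨ cong (λ x → p a *ℚ (x +ℚ B (λ k n → ι k *ℚ φ′ a k n))) (boxSum-*ˡ w l b (suc i) (ι a) (φ′ a)) ⟩
    p a *ℚ (ι a *ℚ B (φ′ a) +ℚ B (λ k n → ι k *ℚ φ′ a k n))
      ≡⟨ rearrange (p a) (ι a) (B (φ′ a)) (B (λ k n → ι k *ℚ φ′ a k n)) ⟩
    _ ∎
    where
    rearrange : ∀ x y z u → x *ℚ (y *ℚ z +ℚ u) ≡ x *ℚ y *ℚ z +ℚ x *ℚ u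
    rearrange = solve-∀-in ℚ-ring

  ψ : ℕ → ℚ
  ψ a = B (λ k n → φ (suc (a + k)) (i + (i * a + n)))

  first-block : ∑ℚ (suc b) (λ a → p a *ℚ ι a *ℚ B (φ′ a)) ≡
                w i *ℚ boxSum w (suc l) b i (λ k n → φ (suc k) (i + n))
  first-block = begin
    p 0 *ℚ ι 0 *ℚ B (φ′ 0) +ℚ ∑ℚ b (λ a → p (suc a) *ℚ ι (suc a) *ℚ B (φ′ (suc a)))
      ≡⟨ cong₂ _+ℚ_ (trans (cong (_*ℚ B (φ′ 0)) (ℚ.*-zeroʳ (p 0))) (ℚ.*-zeroˡ (B (φ′ 0))))
           (∑ℚ-cong b (λ a _ → trans
             (cong₂ _*ℚ_ (dividedPower-suc w i a)
               (boxSum-cong w l b (suc i) (λ k n → cong (φ (suc (a + k)))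
                 (trans (cong (_+ n) (*-suc i a)) (+-assoc i (i * a) n)))))
             (ℚ.*-assoc (w i) (p a) (ψ a)))) ⟩
    0ℚ +ℚ ∑ℚ b (λ a → w i *ℚ (p a *ℚ ψ a))
      ≡⟨ ℚ.+-identityˡ _ ⟩
    ∑ℚ b (λ a → w i *ℚ (p a *ℚ ψ a))
      ≡⟨ ∑ℚ-*ˡ b (w i) (λ a → p a *ℚ ψ a) ⟨
    w i *ℚ ∑ℚ b (λ a → p a *ℚ ψ a)
      -- With one block removed the exponent stops at b - 1. The term a = b may be added because its
      -- test function is evaluated at more than b blocks, outside the support of φ.
      ≡⟨ cong (w i *ℚ_) (sym (trans (∑ℚ-last b (λ a → p a *ℚ ψ a))
           (trans (cong (∑ℚ b (λ a → p a *ℚ ψ a) +ℚ_)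
             (trans (cong (p b *ℚ_) (boxSum-zero w l b (suc i) (λ k n → supp (suc (b + k)) (i + (i * b + n)) (s≤s (m≤m+n b k)))))
               (ℚ.*-zeroʳ (p b))))
             (ℚ.+-identityʳ _)))) ⟩
    w i *ℚ ∑ℚ (suc b) (λ a → p a *ℚ ψ a)
      ≡⟨ cong (w i *ℚ_) (boxSum-suc w l b i (λ k n → φ (suc k) (i + n))) ⟨
    w i *ℚ boxSum w (suc l) b i (λ k n → φ (suc k) (i + n)) ∎

  other-blocks : ∑ℚ (suc b) (λ a → p a *ℚ B (λ k n → ι k *ℚ φ′ a k n)) ≡
    ∑ℚ l (λ t → w (suc t + i) *ℚ boxSum w (suc l) b i (λ k n → φ (suc k) (suc t + i + n)))
  other-blocks = begin
    ∑ℚ (suc b) (λ a → p a *ℚ B (λ k n → ι k *ℚ φ′ a k n))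
      ≡⟨ ∑ℚ-cong (suc b) (λ a _ → trans
           (cong (p a *ℚ_) (boxSum-euler w l b (suc i) (φ′ a)
             (λ k n b<k → supp (a + k) (i * a + n) (≤-trans b<k (m≤n+m k a)))))
           (∑ℚ-*ˡ l (p a) (χ a))) ⟩
    ∑ℚ (suc b) (λ a → ∑ℚ l (λ t → p a *ℚ χ a t))
      ≡⟨ ∑ℚ-comm (suc b) l (λ a t → p a *ℚ χ a t) ⟩
    ∑ℚ l (λ t → ∑ℚ (suc b) (λ a → p a *ℚ χ a t))
      ≡⟨ ∑ℚ-cong l (λ t _ → trans (∑ℚ-cong (suc b) (λ a _ → begin
           p a *ℚ (w (t + suc i) *ℚ B (λ k n → φ (a + suc k) (i * a + (t + suc i + n))))
             ≡⟨ cong₂ (λ x y → p a *ℚ (w x *ℚ y)) (+-suc t i)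
                  (boxSum-cong w l b (suc i) (λ k n → cong₂ φ (+-suc a k) (reindex a t n))) ⟩
           p a *ℚ (w (suc t + i) *ℚ B (λ k n → φ (suc (a + k)) (suc t + i + (i * a + n))))
             ≡⟨ swap (p a) (w (suc t + i)) (B (λ k n → φ (suc (a + k)) (suc t + i + (i * a + n)))) ⟩
           w (suc t + i) *ℚ (p a *ℚ B (λ k n → φ (suc (a + k)) (suc t + i + (i * a + n)))) ∎))
         (trans (sym (∑ℚ-*ˡ (suc b) (w (suc t + i)) (λ a → p a *ℚ B (λ k n → φ (suc (a + k)) (suc t + i + (i * a + n))))))
           (cong (w (suc t + i) *ℚ_) (sym (boxSum-suc w l b i (λ k n → φ (suc k) (suc t + i + n))))))) ⟩
    _ ∎
    where
    χ : ℕ → ℕ → ℚ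
    χ a t = w (t + suc i) *ℚ B (λ k n → φ′ a (suc k) (t + suc i + n))
    reindex : ∀ a t n → i * a + (t + suc i + n) ≡ suc t + i + (i * a + n)
    reindex a t n = shuffle i (i * a) t n
      where
      shuffle : ∀ i x t n → x + (t + suc i + n) ≡ suc t + i + (x + n)
      shuffle = solve-∀
    swap : ∀ x y z → x *ℚ (y *ℚ z) ≡ y *ℚ (x *ℚ z)
    swap = solve-∀-in ℚ-ring

-- Bell polynomials at the Schröder numbers as powers of x S

-- Multiplication of a power series by x^t.
shift : ℕ → (ℕ → ℕ) → ℕ → ℕ
shift zero    q n       = q n
shift (suc t) q zero    = 0
shift (suc t) q (suc n) = shift t q n

shift-+ : ∀ k q m → shift k q (k + m) ≡ q m
shift-+ zero    q m = refl
shift-+ (suc k) q m = shift-+ k q m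

shift-sucʳ : ∀ t k q n → shift t (shift (suc k) q) (suc n) ≡ shift t (shift k q) n
shift-sucʳ zero          k q n       = refl
shift-sucʳ (suc zero)    k q zero    = refl
shift-sucʳ (suc (suc t)) k q zero    = refl
shift-sucʳ (suc t)       k q (suc n) = shift-sucʳ t k q n

shift-suc-zero : ∀ t k q → shift t (shift (suc k) q) 0 ≡ 0
shift-suc-zero zero    k q = refl
shift-suc-zero (suc t) k q = refl

∑-zero : ∀ l {f : ℕ → ℕ} → (∀ t → f t ≡ 0) → ∑[ t < l ] f (toℕ t) ≡ 0
∑-zero l eq = trans (sum-cong-≗ {l} (λ t → eq (toℕ t))) (sum-replicate-zero l)

conv-as-shifts : ∀ l p q n → n < l → ∑[ t < l ] (p (toℕ t) * shift (toℕ t) q n) ≡ conv p q n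
conv-as-shifts (suc l) p q zero    _        =
  cong ((p 0 * q 0) +_) (∑-zero l (λ t → *-zeroʳ (p (suc t))))
conv-as-shifts (suc l) p q (suc n) (s≤s lt) =
  cong ((p 0 * q (suc n)) +_) (conv-as-shifts l (p ∘ suc) q n lt)

-- One factor is divisible by x^k, so cutting the other off after `l` terms affects only degrees k +
-- l and above.
conv-shift : ∀ l p q k n → n < k + l →
  ∑[ t < l ] (p (toℕ t) * shift (toℕ t) (shift k q) n) ≡ shift k (conv p q) n
conv-shift l p q zero    n       lt = conv-as-shifts l p q n lt
conv-shift l p q (suc k) zero    lt =
  ∑-zero l (λ t → trans (cong (p t *_) (shift-suc-zero t k q)) (*-zeroʳ (p t)))
conv-shift l p q (suc k) (suc n) (s≤s lt) = trans
  (sum-cong-≗ {l} (λ t → cong (p (toℕ t) *_) (shift-sucʳ (toℕ t) k q n)))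
  (conv-shift l p q k n lt)

ι-∑ : ∀ l (f : ℕ → ℕ) → ι (∑[ t < l ] f (toℕ t)) ≡ ∑ℚ l (ι ∘ f)
ι-∑ zero    f = refl
ι-∑ (suc l) f = trans (ι-+ (f 0) _) (cong (ι (f 0) +ℚ_) (ι-∑ l (f ∘ suc)))

-- The factorials cancel. A block of size t + 1 has weight s_t, so the series of blocks is x S
-- rather than S.
divided-zSchroder : ∀ t → divided zSchroder (suc t) ≡ ι (K 0 1 t)
divided-zSchroder t = begin
  ι (suc t ! * s t) *ℚ inv (suc t !) {{suc t !≢0}}
    ≡⟨ cong (_*ℚ inv (suc t !) {{suc t !≢0}}) (ι-* (suc t !) (s t)) ⟩
  ι (suc t !) *ℚ ι (s t) *ℚ inv (suc t !) {{suc t !≢0}}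
    ≡⟨ rearrange (ι (suc t !)) (ι (s t)) (inv (suc t !) {{suc t !≢0}}) ⟩
  ι (suc t !) *ℚ inv (suc t !) {{suc t !≢0}} *ℚ ι (s t)
    ≡⟨ cong₂ _*ℚ_ (ι-inv (suc t !) {{suc t !≢0}}) (cong ι (s≡K t)) ⟩
  1ℚ *ℚ ι (K 0 1 t)
    ≡⟨ ℚ.*-identityˡ _ ⟩
  ι (K 0 1 t) ∎
  where
  rearrange : ∀ a b c → a *ℚ b *ℚ c ≡ a *ℚ c *ℚ b
  rearrange = solve-∀-in ℚ-ring

δ-zeroʳ : ∀ k k′ n′ → δ k 0 k′ (suc n′) ≡ 0ℚ
δ-zeroʳ k k′ n′ rewrite ∧-falseʳ (k′ ≡ᵇ k) {false} refl = refl

-- Makes the left side of the Euler identity a plain multiple by k.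
δ-eigen : ∀ k n k′ n′ → ι k′ *ℚ δ k n k′ n′ ≡ ι k *ℚ δ k n k′ n′
δ-eigen k n k′ n′ with k′ ≟ k
... | yes refl = refl
... | no k′≢k rewrite dec-false (k′ ≟ k) k′≢k = trans (ℚ.*-zeroʳ (ι k′)) (sym (ℚ.*-zeroʳ (ι k)))

δ-support : ∀ b k n → k ≤ b → ∀ k′ n′ → b < k′ → δ k n k′ n′ ≡ 0ℚ
δ-support b k n k≤b k′ n′ b<k′
  rewrite dec-false (k′ ≟ k) (λ eq → <-irrefl (sym eq) (≤-trans (s≤s k≤b) b<k′)) = refl

boxSum-δ-zero : ∀ w l b i n → boxSum w l b i (δ 0 n) ≡ ι (K 0 0 n)
boxSum-δ-zero w zero    b i zero    = refl
boxSum-δ-zero w zero    b i (suc n) = refl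
boxSum-δ-zero w (suc l) b i n = begin
  boxSum w (suc l) b i (δ 0 n)
    ≡⟨ boxSum-suc w l b i (δ 0 n) ⟩
  1ℚ *ℚ boxSum w l b (suc i) (λ k′ n′ → δ 0 n k′ (i * 0 + n′)) +ℚ
    ∑ℚ b (λ a → dividedPower w i (suc a) *ℚ boxSum w l b (suc i) (λ k′ n′ → δ 0 n (suc a + k′) (i * suc a + n′)))
    ≡⟨ cong₂ _+ℚ_
         (trans (ℚ.*-identityˡ _)
           (boxSum-cong w l b (suc i) (λ k′ n′ → cong (λ x → δ 0 n k′ (x + n′)) (*-zeroʳ i))))
         (∑ℚ-zero b (λ a → trans
           (cong (dividedPower w i (suc a) *ℚ_) (boxSum-zero w l b (suc i) (λ _ _ → refl)))
           (ℚ.*-zeroʳ (dividedPower w i (suc a))))) ⟩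
  boxSum w l b (suc i) (δ 0 n) +ℚ 0ℚ
    ≡⟨ ℚ.+-identityʳ _ ⟩
  boxSum w l b (suc i) (δ 0 n)
    ≡⟨ boxSum-δ-zero w l b (suc i) n ⟩
  ι (K 0 0 n) ∎

-- Translating δ by t tests at n - t, or gives zero when t > n, just as `shift` does. The scalar `r`
-- stands for the k! of the induction hypothesis in `boxSum-power`.
boxSum-δ-shift : ∀ w l b i r k (q : ℕ → ℕ) t n →
  (∀ n′ → n′ ≤ n → r *ℚ boxSum w l b i (δ k n′) ≡ ι (q n′)) →
  r *ℚ boxSum w l b i (λ k′ n′ → δ k n k′ (t + n′)) ≡ ι (shift t q n)
boxSum-δ-shift w l b i r k q zero    n       eq = eq n ≤-refl
boxSum-δ-shift w l b i r k q (suc t) zero    eq =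
  trans (cong (r *ℚ_) (boxSum-zero w l b i (λ k′ n′ → δ-zeroʳ k k′ (t + n′)))) (ℚ.*-zeroʳ r)
boxSum-δ-shift w l b i r k q (suc t) (suc n) eq =
  boxSum-δ-shift w l b i r k q t n (λ n′ n′≤n → eq n′ (m≤n⇒m≤1+n n′≤n))

-- k! times the tested sum is the coefficient of x^n in (x S)^k; only the first l
-- terms of S matter because n < k + l.
boxSum-power : ∀ l b k n → k ≤ b → n < k + l →
  ι (k !) *ℚ boxSum (divided zSchroder) l b 1 (δ k n) ≡ ι (shift k (K 0 k) n)
boxSum-power l b zero    n k≤b lt =
  trans (ℚ.*-identityˡ _) (boxSum-δ-zero (divided zSchroder) l b 1 n)
boxSum-power l b (suc k) n k<b lt = begin
  ι (suc k * k !) *ℚ B (δ (suc k) n)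
    ≡⟨ cong (_*ℚ B (δ (suc k) n)) (ι-* (suc k) (k !)) ⟩
  ι (suc k) *ℚ ι (k !) *ℚ B (δ (suc k) n)
    ≡⟨ rearrange (ι (suc k)) (ι (k !)) (B (δ (suc k) n)) ⟩
  ι (k !) *ℚ (ι (suc k) *ℚ B (δ (suc k) n))
    ≡⟨ cong (ι (k !) *ℚ_) (boxSum-*ˡ w l b 1 (ι (suc k)) (δ (suc k) n)) ⟨
  ι (k !) *ℚ B (λ k′ n′ → ι (suc k) *ℚ δ (suc k) n k′ n′)
    ≡⟨ cong (ι (k !) *ℚ_) (boxSum-cong w l b 1 (λ k′ n′ → sym (δ-eigen (suc k) n k′ n′))) ⟩
  ι (k !) *ℚ B (λ k′ n′ → ι k′ *ℚ δ (suc k) n k′ n′)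
    ≡⟨ cong (ι (k !) *ℚ_) (boxSum-euler w l b 1 (δ (suc k) n) (δ-support b (suc k) n k<b)) ⟩
  ι (k !) *ℚ ∑ℚ l (λ t → w (t + 1) *ℚ B (λ k′ n′ → δ (suc k) n (suc k′) (t + 1 + n′)))
    ≡⟨ ∑ℚ-*ˡ l (ι (k !)) (λ t → w (t + 1) *ℚ B (λ k′ n′ → δ (suc k) n (suc k′) (t + 1 + n′))) ⟩
  ∑ℚ l (λ t → ι (k !) *ℚ (w (t + 1) *ℚ B (λ k′ n′ → δ (suc k) n (suc k′) (t + 1 + n′))))
    ≡⟨ ∑ℚ-cong l (λ t _ → begin
         ι (k !) *ℚ (w (t + 1) *ℚ B (λ k′ n′ → δ (suc k) n (suc k′) (t + 1 + n′)))
           ≡⟨ cong (λ u → ι (k !) *ℚ (w u *ℚ B (λ k′ n′ → δ (suc k) n (suc k′) (u + n′)))) (+-comm t 1) ⟩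
         ι (k !) *ℚ (w (suc t) *ℚ B (λ k′ n′ → δ (suc k) n (suc k′) (suc t + n′)))
           ≡⟨ swap (ι (k !)) (w (suc t)) (B (λ k′ n′ → δ (suc k) n (suc k′) (suc t + n′))) ⟩
         w (suc t) *ℚ (ι (k !) *ℚ B (λ k′ n′ → δ (suc k) n (suc k′) (suc t + n′)))
           ≡⟨ cong₂ _*ℚ_ (divided-zSchroder t) (remove-block t n lt) ⟩
         ι (K 0 1 t) *ℚ ι (q t n)
           ≡⟨ ι-* (K 0 1 t) (q t n) ⟨
         ι (K 0 1 t * q t n) ∎) ⟩
  ∑ℚ l (λ t → ι (K 0 1 t * q t n))
    ≡⟨ ι-∑ l (λ t → K 0 1 t * q t n) ⟨
  ι (∑[ t < l ] (K 0 1 (toℕ t) * q (toℕ t) n))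
    ≡⟨ cong ι (convolve n lt) ⟩
  ι (shift (suc k) (K 0 (suc k)) n) ∎
  where
  w : ℕ → ℚ
  w = divided zSchroder
  B : (ℕ → ℕ → ℚ) → ℚ
  B = boxSum w l b 1
  q : ℕ → ℕ → ℕ
  q t n = shift (suc t) (shift k (K 0 k)) n
  rearrange : ∀ x y z → x *ℚ y *ℚ z ≡ y *ℚ (x *ℚ z)
  rearrange = solve-∀-in ℚ-ring
  swap : ∀ x y z → x *ℚ (y *ℚ z) ≡ y *ℚ (x *ℚ z)
  swap = solve-∀-in ℚ-ring
  remove-block : ∀ t n → n < suc k + l →
    ι (k !) *ℚ B (λ k′ n′ → δ (suc k) n (suc k′) (suc t + n′)) ≡ ι (q t n)
  remove-block t zero    lt =
    trans (cong (ι (k !) *ℚ_) (boxSum-zero w l b 1 (λ k′ n′ → δ-zeroʳ k k′ n′))) (ℚ.*-zeroʳ (ι (k !)))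
  -- Every block has size at least 1, so the block count and the degree drop together and the bound
  -- n < k + l is inherited.
  remove-block t (suc n) (s≤s lt) = boxSum-δ-shift w l b 1 (ι (k !)) k (shift k (K 0 k)) t n
    (λ n′ n′≤n → boxSum-power l b k n′ (<⇒≤ k<b) (≤-<-trans n′≤n lt))
  shift-cong : ∀ k {q q′ : ℕ → ℕ} → (∀ m → q m ≡ q′ m) → ∀ n → shift k q n ≡ shift k q′ n
  shift-cong zero    eq n       = eq n
  shift-cong (suc k) eq zero    = refl
  shift-cong (suc k) eq (suc n) = shift-cong k eq n
  convolve : ∀ n → n < suc k + l → ∑[ t < l ] (K 0 1 (toℕ t) * q (toℕ t) n) ≡ shift (suc k) (K 0 (suc k)) n
  convolve zero    lt       = ∑-zero l (λ t → *-zeroʳ (K 0 1 t))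
  convolve (suc n) (s≤s lt) = trans (conv-shift l (K 0 1) (K 0 k) k n lt) (shift-cong k (K-conv 0 k) n)

bell-value : ∀ k m → bell (k + m) k zSchroder ≡ ι ((k + m) !) *ℚ (inv (k !) {{k !≢0}} *ℚ ι (K 0 k m))
bell-value k m = trans (bell-boxSum (k + m) k zSchroder) (cong (ι ((k + m) !) *ℚ_)
  (trans (solve-for (k !) {{k !≢0}} (boxSum-power (suc ((k + m) ∸ k)) k k (k + m) ≤-refl k+m<))
    (cong (λ x → inv (k !) {{k !≢0}} *ℚ ι x) (shift-+ k (K 0 k) m))))
  where
  -- The n - k + 1 variables of the Bell polynomial are exactly enough: k + l = n + 1.
  k+m< : k + m < k + suc (k + m ∸ k)
  k+m< = ≤-reflexive (trans (sym (+-suc k m)) (cong (λ x → k + suc x) (sym (m+n∸m≡n k m))))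

-- Matching the closed form

-- Both sides are the coefficient of u^j in the derivative of (1 + u)^(m+1).
absorption : ∀ m j → suc j * (suc m C suc j) ≡ suc m * (m C j)
absorption m j = begin
  suc j * (suc m C suc j)       ≡⟨ cong (suc j *_) (c-binomial (suc m) (suc j)) ⟨
  suc j * c (suc m) 0 (suc j)   ≡⟨ c-derivative (suc m) 0 j ⟩
  suc m * c m 0 j + 0           ≡⟨ +-identityʳ _ ⟩
  suc m * c m 0 j               ≡⟨ cong (suc m *_) (c-binomial m j) ⟩
  suc m * (m C j)               ∎

∑-last : ∀ n f → ∑[ t < suc n ] f (toℕ t) ≡ ∑[ t < n ] f (toℕ t) + f n
∑-last n f = trans (sum-init-last {n} (f ∘ toℕ))
  (cong₂ _+_ (sum-cong-≗ {n} (λ t → cong f (toℕ-inject₁ t))) (cong f (toℕ-fromℕ n)))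

shiftSum-∑ : ∀ b y → shiftSum b y ≡ ∑[ j < suc b ] ((b C toℕ j) * y (toℕ j))
shiftSum-∑ zero    y = sym (trans (+-identityʳ _) (*-identityˡ (y 0)))
shiftSum-∑ (suc b) y = begin
  shiftSum b y + shiftSum b (y ∘ suc)
    ≡⟨ cong₂ _+_ (shiftSum-∑ b y) (shiftSum-∑ b (y ∘ suc)) ⟩
  1 * y 0 + upper b + lower
    -- The added term carries C(b, b+1) = 0 and gives both sums the same range, ready for Pascal's
    -- rule.
    ≡⟨ cong (λ x → 1 * y 0 + x + lower) (sym (trans (∑-last b (λ j → (b C suc j) * y (suc j)))
         (trans (cong (λ x → upper b + x * y (suc b)) (k>n⇒nCk≡0 (n<1+n b))) (+-identityʳ (upper b))))) ⟩
  1 * y 0 + upper (suc b) + lower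
    ≡⟨ rearrange (y 0) (upper (suc b)) lower ⟩
  1 * y 0 + (lower + upper (suc b))
    ≡⟨ cong ((1 * y 0) +_) (∑-distrib-+ {suc b} (λ j → (b C toℕ j) * y (suc (toℕ j))) (λ j → (b C suc (toℕ j)) * y (suc (toℕ j)))) ⟨
  1 * y 0 + ∑[ j < suc b ] ((b C toℕ j) * y (suc (toℕ j)) + (b C suc (toℕ j)) * y (suc (toℕ j)))
    ≡⟨ cong ((1 * y 0) +_) (sum-cong-≗ {suc b} (λ j → trans
         (sym (*-distribʳ-+ (y (suc (toℕ j))) (b C toℕ j) (b C suc (toℕ j))))
         (cong (_* y (suc (toℕ j))) (nCk+nC[k+1]≡[n+1]C[k+1] b (toℕ j))))) ⟩
  ∑[ j < 2 + b ] ((suc b C toℕ j) * y (toℕ j)) ∎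
  where
  lower : ℕ
  lower = ∑[ j < suc b ] ((b C toℕ j) * y (suc (toℕ j)))
  upper : ℕ → ℕ
  upper n = ∑[ j < n ] ((b C suc (toℕ j)) * y (suc (toℕ j)))
  rearrange : ∀ a b c → 1 * a + b + c ≡ 1 * a + (c + b)
  rearrange = solve-∀

-- With n = k + m + 1 and j replaced by j + 1, this is n - k times the sum in the theorem, its
-- denominators cleared by `absorption`.
binomialSum : ℕ → ℕ → ℕ
binomialSum k m = ∑[ j < suc m ] ((suc m C suc (toℕ j)) * ((k + m + suc (toℕ j)) C toℕ j))

K-binomialSum : ∀ k m → suc m * K 0 k (suc m) ≡ k * binomialSum k m
K-binomialSum k m = begin
  suc m * K 0 k (suc m)
    ≡⟨ K-closed k m ⟩
  k * c a (suc m) m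
    ≡⟨ cong (k *_) (c-shiftSum (suc m) a m (suc a) (sym (+-suc a m))) ⟩
  k * shiftSum (suc m) (λ j → (a + j) C suc a)
    ≡⟨ cong (k *_) (shiftSum-∑ (suc m) (λ j → (a + j) C suc a)) ⟩
  k * (1 * ((a + 0) C suc a) + ∑[ j < suc m ] ((suc m C suc (toℕ j)) * ((a + suc (toℕ j)) C suc a)))
    -- The term j = 0 is C(a, a+1) = 0, which is why the final sum starts at j = 1.
    ≡⟨ cong₂ (λ x y → k * (1 * x + y)) (k>n⇒nCk≡0 (s≤s (≤-reflexive (+-identityʳ a))))
         (sum-cong-≗ {suc m} (λ j → cong ((suc m C suc (toℕ j)) *_) (symmetry (toℕ j)))) ⟩
  k * binomialSum k m ∎
  where
  a = k + m
  symmetry : ∀ j → (a + suc j) C suc a ≡ (a + suc j) C j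
  symmetry j = trans
    (nCk≡nC[n∸k] (≤-trans (s≤s (m≤m+n a j)) (≤-reflexive (sym (+-suc a j)))))
    (cong ((a + suc j) C_) (trans (cong (_∸ suc a) (+-suc a j)) (m+n∸m≡n a j)))

sumFrom1-∑ℚ : ∀ m (f : (j : ℕ) → .{{NonZero j}} → ℚ) → sumFrom1 m f ≡ ∑ℚ m (λ j → f (suc j))
sumFrom1-∑ℚ zero    f = refl
sumFrom1-∑ℚ (suc m) f = trans (cong (_+ℚ f (suc m)) (sumFrom1-∑ℚ m f)) (sym (∑ℚ-last m (λ j → f (suc j))))

sumFrom1-binomialSum : ∀ k m → ι (suc m) *ℚ sumFrom1 (suc m) (λ j →
    inv j *ℚ ι ((m C (j ∸ 1)) * ((suc (k + m) + j ∸ 1) C (j ∸ 1))))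
  ≡ ι (binomialSum k m)
sumFrom1-binomialSum k m = begin
  ι (suc m) *ℚ sumFrom1 (suc m) (λ j → inv j *ℚ ι ((m C (j ∸ 1)) * ((suc (k + m) + j ∸ 1) C (j ∸ 1))))
    ≡⟨ cong (ι (suc m) *ℚ_) (sumFrom1-∑ℚ (suc m) (λ j → inv j *ℚ ι ((m C (j ∸ 1)) * ((suc (k + m) + j ∸ 1) C (j ∸ 1))))) ⟩
  ι (suc m) *ℚ ∑ℚ (suc m) (λ j → inv (suc j) *ℚ ι ((m C j) * d j))
    ≡⟨ ∑ℚ-*ˡ (suc m) (ι (suc m)) (λ j → inv (suc j) *ℚ ι ((m C j) * d j)) ⟩
  ∑ℚ (suc m) (λ j → ι (suc m) *ℚ (inv (suc j) *ℚ ι ((m C j) * d j)))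
    ≡⟨ ∑ℚ-cong (suc m) (λ j _ → summand j) ⟩
  ∑ℚ (suc m) (λ j → ι ((suc m C suc j) * d j))
    ≡⟨ ι-∑ (suc m) (λ j → (suc m C suc j) * d j) ⟨
  ι (binomialSum k m) ∎
  where
  d : ℕ → ℕ
  d j = (k + m + suc j) C j
  swap : ∀ x y z → x *ℚ (y *ℚ z) ≡ y *ℚ (x *ℚ z)
  swap = solve-∀-in ℚ-ring
  summand : ∀ j → ι (suc m) *ℚ (inv (suc j) *ℚ ι ((m C j) * d j)) ≡ ι ((suc m C suc j) * d j)
  summand j = begin
    ι (suc m) *ℚ (inv (suc j) *ℚ ι ((m C j) * d j))
      ≡⟨ swap (ι (suc m)) (inv (suc j)) (ι ((m C j) * d j)) ⟩
    inv (suc j) *ℚ (ι (suc m) *ℚ ι ((m C j) * d j))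
      ≡⟨ solve-for (suc j) (begin
           ι (suc j) *ℚ ι ((suc m C suc j) * d j) ≡⟨ ι-* (suc j) ((suc m C suc j) * d j) ⟨
           ι (suc j * ((suc m C suc j) * d j))    ≡⟨ cong ι (trans (sym (*-assoc (suc j) (suc m C suc j) (d j)))
                                                       (trans (cong (_* d j) (absorption m j)) (*-assoc (suc m) (m C j) (d j)))) ⟩
           ι (suc m * ((m C j) * d j))            ≡⟨ ι-* (suc m) ((m C j) * d j) ⟩
           ι (suc m) *ℚ ι ((m C j) * d j)         ∎) ⟨
    ι ((suc m C suc j) * d j) ∎

rhs-value : ∀ k m → rhs (suc k + suc m) (suc k) ≡
  ι ((suc k + suc m) !) *ℚ inv (k !) {{k !≢0}} *ℚ (inv (suc m) *ℚ ι (binomialSum (suc k) m))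
rhs-value k m = cong₂ _*ℚ_ (/-inv ((suc k + suc m) !) (k !) {{k !≢0}}) (begin
  sumFrom1 (k + suc m ∸ k) (summand (k + suc m) (k + suc m ∸ k))
    ≡⟨ cong (λ x → sumFrom1 x (summand (k + suc m) x)) (m+n∸m≡n k (suc m)) ⟩
  sumFrom1 (suc m) (summand (k + suc m) (suc m))
    ≡⟨ cong (λ x → sumFrom1 (suc m) (summand x (suc m))) (+-suc k m) ⟩
  sumFrom1 (suc m) (summand (suc k + m) (suc m))
    ≡⟨ solve-for (suc m) (sumFrom1-binomialSum (suc k) m) ⟩
  inv (suc m) *ℚ ι (binomialSum (suc k) m) ∎)
  where
  summand : ℕ → ℕ → (j : ℕ) → .{{NonZero j}} → ℚ
  summand n m j = inv j *ℚ ι (((m ∸ 1) C (j ∸ 1)) * ((suc n + j ∸ 1) C (j ∸ 1)))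

-- The factor k produced by Lagrange inversion turns the 1/k! of the Bell polynomial into 1/(k-1)!;
-- here k is `suc k`.
bell≡rhs : ∀ k m → bell (suc k + suc m) (suc k) zSchroder ≡ rhs (suc k + suc m) (suc k)
bell≡rhs k m = begin
  bell (suc k + suc m) (suc k) zSchroder
    ≡⟨ bell-value (suc k) (suc m) ⟩
  n! *ℚ (inv (suc k * k !) {{suc k !≢0}} *ℚ ι (K 0 (suc k) (suc m)))
    ≡⟨ cong₂ (λ x y → n! *ℚ (x *ℚ y)) (inv-* (suc k) (k !) {{_}} {{k !≢0}} {{suc k !≢0}})
         (solve-for (suc m) (begin
           ι (suc m) *ℚ ι (K 0 (suc k) (suc m))   ≡⟨ ι-* (suc m) (K 0 (suc k) (suc m)) ⟨
           ι (suc m * K 0 (suc k) (suc m))        ≡⟨ cong ι (K-binomialSum (suc k) m) ⟩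
           ι (suc k * binomialSum (suc k) m)      ≡⟨ ι-* (suc k) (binomialSum (suc k) m) ⟩
           ι (suc k) *ℚ ι (binomialSum (suc k) m) ∎)) ⟩
  n! *ℚ (inv (suc k) *ℚ k!⁻¹ *ℚ (inv (suc m) *ℚ (ι (suc k) *ℚ σ)))
    ≡⟨ rearrange n! (inv (suc k)) k!⁻¹ (inv (suc m)) (ι (suc k)) σ ⟩
  ι (suc k) *ℚ inv (suc k) *ℚ (n! *ℚ k!⁻¹ *ℚ (inv (suc m) *ℚ σ))
    ≡⟨ cong (_*ℚ (n! *ℚ k!⁻¹ *ℚ (inv (suc m) *ℚ σ))) (ι-inv (suc k)) ⟩
  1ℚ *ℚ (n! *ℚ k!⁻¹ *ℚ (inv (suc m) *ℚ σ))
    ≡⟨ ℚ.*-identityˡ _ ⟩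
  n! *ℚ k!⁻¹ *ℚ (inv (suc m) *ℚ σ)
    ≡⟨ rhs-value k m ⟨
  rhs (suc k + suc m) (suc k) ∎
  where
  n! k!⁻¹ σ : ℚ
  n! = ι ((suc k + suc m) !)
  k!⁻¹ = inv (k !) {{k !≢0}}
  σ = ι (binomialSum (suc k) m)
  rearrange : ∀ a b c d e f → a *ℚ (b *ℚ c *ℚ (d *ℚ (e *ℚ f))) ≡ e *ℚ b *ℚ (a *ℚ c *ℚ (d *ℚ f))
  rearrange = solve-∀-in ℚ-ring

theorem2p2 : (n k : ℕ) → 1 ≤ k → k < n →
    bell n k zSchroder ≡ rhs n k
theorem2p2 n (suc k) _ k<n = subst (λ n → bell n (suc k) zSchroder ≡ rhs n (suc k))
  (trans (+-suc (suc k) _) (m+[n∸m]≡n k<n)) (bell≡rhs k (n ∸ suc (suc k)))
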